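{- Let $q=2^{m}$ with $m\ge 1$, and let $r,s$ be positive integers with $s\equiv r+3\pmod{q+1}$. Let $B(x)\in\mathbb{F}_{q^2}[x]$ be such that $B(x)$ has no root in $\mu_{q+1}$ and $x\mapsto x^{r}B^{(q)}(1/x)/B(x)$ permutes $\mu_{q+1}$. Let $a\in\mathbb{F}_{q^2}\setminus\mathbb{F}_q$ and $b\in\mathbb{F}_q^{*}$ with $a^{q+1}+b^{2}\neq 0$. Then $$x^{s}B(x^{q-1})\left(a^{q}+bx^{q-1}+bx^{2(q-1)}+ax^{3(q-1)}\right)$$ permutes $\mathbb{F}_{q^2}$ if and only if the following three conditions hold: (i) $\gcd(s,q-1)=1$; (ii) $\mathrm{Tr}\left(\dfrac{(a^{q}+b)^{3}(a+b)^{3}}{(a+a^{q})^{2}(a^{q+1}+b^{2})^{2}}\right)=\mathrm{Tr}(1)$; (iii) for any $\delta\in\mathbb{F}_{q^2}\setminus\mathbb{F}_q$, the roots $t_1,t_2$ of $$x^{2}+\frac{(\delta^{q}+\delta)^{3}(a^{q+1}+b^{2})}{(a+a^{q})^{2}}\,x+\frac{(\delta+\delta^{q})^{6}(a^{q}+b)^{3}(a+b)^{3}}{(a+a^{q})^{6}}$$ are not cubes in $\mathbb{F}_q$ if $m$ is even, and are not cubes in $\mathbb{F}_{q^2}$ if $m$ is odd.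
   Context: $\mu_{q+1}$ denotes the set of $(q+1)$-th roots of unity in $\mathbb{F}_{q^2}$. For $B(x)\in\mathbb{F}_{q^2}[x]$, $B^{(q)}(x)$ denotes the polynomial obtained from $B(x)$ by raising every coefficient to the $q$-th power. $\mathrm{Tr}$ is the absolute trace $\mathbb{F}_q\to\mathbb{F}_2$, $\mathrm{Tr}(x)=x+x^2+x^{2^2}+\cdots+x^{2^{m-1}}$. A polynomial permutes a finite set if it induces a bijection of that set onto itself. -}

module Defs where

open import Algebra.Bundles using (CommutativeRing; Semiring)
import Algebra.Definitions.RawSemiring as RawSemiringDefs
open import Algebra.Core using (Op₁; Op₂)
open import Data.Fin.Base using (Fin; toℕ)
open import Data.List.Base using (List; foldr; map)
open import Data.Nat.Base as ℕ using (ℕ)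
open import Data.Product.Base using (Σ; Σ-syntax; ∃-syntax; _×_; _,_; proj₁)
open import Function.Base using (_on_)
open import Function.Bundles using (Inverse)
open import Function.Definitions using (Bijective)
open import Level using (Level; suc; _⊔_)
open import Relation.Binary.Core using (Rel)
open import Relation.Binary.PropositionalEquality using (setoid)
open import Relation.Unary using (Pred; _∈_)

-- The value of the inverse at zero is left unspecified.
record FiniteField (c ℓ : Level) (n : ℕ) : Set (suc (c ⊔ ℓ)) where
  infix  9 _⁻¹
  field
    commutativeRing : CommutativeRing c ℓ
  open CommutativeRing commutativeRing public hiding (setoid)
  field
    _⁻¹         : Op₁ Carrier
    ⁻¹-cong     : ∀ {x y} → x ≈ y → x ⁻¹ ≈ y ⁻¹
    0≉1         : 0# ≉ 1#
    *-inverseʳ  : ∀ x → x ≉ 0# → x * x ⁻¹ ≈ 1#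
    enumeration : Inverse (CommutativeRing.setoid commutativeRing) (setoid (Fin n))

module FieldNotions {c ℓ : Level} {n : ℕ} (K : FiniteField c ℓ n) where

  open FiniteField K public
  open RawSemiringDefs (Semiring.rawSemiring semiring) public using (_^_; sum)

  infixl 7 _/_
  _/_ : Op₂ Carrier
  x / y = x * y ⁻¹

  -- When K has q² elements, the solutions of x^q = x are the elements of its
  -- unique subfield with q elements.
  𝔽 : ℕ → Pred Carrier ℓ
  𝔽 q x = x ^ q ≈ x

  μ : ℕ → Pred Carrier ℓ
  μ k x = x ^ k ≈ 1#

  -- x + x² + x^(2²) + ⋯ + x^(2^(m-1)).  On 𝔽 (2^m) this is the absolute trace,
  -- with its values 0 and 1 read in K.
  Tr : ℕ → Carrier → Carrier
  Tr m x = sum {m} (λ i → x ^ (2 ℕ.^ toℕ i))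

  -- Coefficients in increasing degree; trailing zeros are allowed.
  Polynomial : Set c
  Polynomial = List Carrier

  eval : Polynomial → Carrier → Carrier
  eval B x = foldr (λ b v → b + x * v) 0# B

  -- B^(q): every coefficient raised to the q-th power.
  _⁽_⁾ : Polynomial → ℕ → Polynomial
  B ⁽ q ⁾ = map (_^ q) B

  -- f maps the set S to itself, and the induced map S → S is a bijection.
  Permutes : ∀ {p} → (Carrier → Carrier) → Pred Carrier p → Set (c ⊔ ℓ ⊔ p)
  Permutes f S =
    Σ[ closed ∈ (∀ {x} → x ∈ S → f x ∈ S) ]
      Bijective _≈ₛ_ _≈ₛ_ (λ (x , x∈S) → f x , closed x∈S)
    where
    _≈ₛ_ : Rel (Σ Carrier S) ℓ
    _≈ₛ_ = _≈_ on proj₁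

  IsCubeIn : ∀ {p} → Pred Carrier p → Carrier → Set (c ⊔ ℓ ⊔ p)
  IsCubeIn S t = ∃[ y ] (y ∈ S × y ^ 3 ≈ t)

-- Write A(z) = a^q + b z + b z² + a z³.  Since A(z)^q z³ = A(z) on μ_{q+1}, the map
-- f(x) = x^s B(x^{q-1}) A(x^{q-1}) satisfies f(x)^q = f(x) h(x^{q-1}) with h the given permutation of
-- μ_{q+1}.  Hence f is injective if gcd(s, q-1) = 1 and A has no root in μ_{q+1}; both conditions are
-- also necessary.  The substitution z = (x + b + a^q)/(x + b + a) matches the roots of A in μ_{q+1}
-- with the roots in 𝔽_q of x³ + α x + β, where α = (a^q + b)(a + b) and β = (a + a^q)(a^{q+1} + b²).
-- By Cardano's substitution x = y + α/y, a root x corresponds to a cube root y of a root of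
-- u² + β u + α³, and the trace of α³/β² tells whether u and its conjugate lie in 𝔽_q.
module Submission where

open import Defs
open import Algebra.Bundles using (CommutativeMonoid; CommutativeRing)
import Algebra.Properties.CommutativeMonoid.Sum as CommutativeMonoidSum
import Algebra.Properties.CommutativeSemiring.Exp as CommutativeSemiringExp
import Algebra.Properties.Ring as RingProperties
import Algebra.Properties.Semiring.Exp as SemiringExp
import Algebra.Properties.Semiring.Mult as SemiringMult
import Algebra.Solver.Ring as RingSolver
open import Algebra.Solver.Ring.AlmostCommutativeRing using (_-Raw-AlmostCommutative⟶_; fromCommutativeRing)
import Algebra.Solver.Ring.NaturalCoefficients.Default as SemiringSolver
open import Data.Bool.Base using (true; false)
open import Data.Bool.Properties using (xor-∧-commutativeRing)
open import Data.Fin.Base using (Fin; zero; suc; toℕ; punchIn; punchOut)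
import Data.Fin.Properties as Fin
open import Data.List.Base using ([]; _∷_; _++_; replicate; length)
open import Data.List.Properties using (length-++; length-replicate)
open import Data.Maybe.Base using (Maybe; just; nothing)
open import Data.Nat as ℕ using (ℕ; zero; suc; _∸_; _≥_; _%_; z≤n; s≤s)
open import Data.Nat.Divisibility using (_∣_; _∤_; divides)
open import Data.Nat.DivMod using (m≡m%n+[m/n]*n)
open import Data.Nat.GCD using (gcd; gcd[m,n]∣m; gcd[m,n]∣n; gcd-GCD; module Bézout)
import Data.Nat.Properties as ℕ
open import Data.Nat.Solver using (module +-*-Solver)
open import Data.Product using (_×_; _,_; proj₁; proj₂; Σ-syntax; ∃-syntax)
open import Data.Sum using (_⊎_; inj₁; inj₂)
open import Function.Base using (_∘_)
open import Function.Bundles using (_⇔_; mk⇔; mk↔ₛ′; Equivalence; Inverse)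
open import Function.Definitions using (Injective)
open import Level using (Level)
open import Relation.Binary.Definitions using (Decidable)
open import Relation.Binary.PropositionalEquality as ≡ using (_≡_; _≢_)
import Relation.Binary.Reasoning.Setoid as SetoidReasoning
open import Relation.Nullary using (¬_; yes; no; contradiction)
open import Relation.Nullary.Decidable using (map′)
open import Relation.Unary using (_∈_; _∉_; U)

-- A `FiniteField` supplies inverses and an enumeration, so characteristic 2, x^(q²) = x and the
-- bound on exponents are obtained by counting, and the subfield is handled through the conjugation
-- x ↦ x^q. No generator of the multiplicative group enters: cube roots are explicit powers, and
-- preimages under x ↦ x^(q-1) are explicit sums. Tr(1) is the parity of m, and this parity joins
-- (ii) to (iii). If m is even, then 3 divides q + 2, and trace 1 would give every u a cube root of
-- norm α, hence a root x; so the trace must be 0. If m is odd, then 3 divides 2q - 1 and every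
-- element of 𝔽_q is a cube there; so the trace must be 1. In the remaining case only cubeness
-- decides, in 𝔽_q for even m and in the whole field for odd m. In z = (x + b + a^q)/(x + b + a) the
-- numerator is the conjugate of the denominator when x ∈ 𝔽_q, which puts z into μ_{q+1}; the shift
-- by b removes the x² term.

-- Finite sums and injections between finite sets.

sum-single : ∀ {c ℓ} (M : CommutativeMonoid c ℓ) → let open CommutativeMonoid M in
             let open CommutativeMonoidSum M using (sum) in
             ∀ {n} (t : Fin n → Carrier) i → (∀ j → j ≢ i → t j ≈ ε) → sum t ≈ t i
sum-single M {suc n} t i t≈ε = begin
  sum t                             ≈⟨ sum-remove {i = i} t ⟩
  t i ∙ sum (t ∘ punchIn i)         ≈⟨ ∙-congˡ (sum-cong-≋ {x = t ∘ punchIn i} {y = λ _ → ε} (λ j → t≈ε _ (Fin.punchInᵢ≢i i j))) ⟩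
  t i ∙ sum {n} (λ _ → ε)           ≈⟨ ∙-congˡ (sum-replicate-zero n) ⟩
  t i ∙ ε                           ≈⟨ identityʳ (t i) ⟩
  t i                               ∎
  where
  open CommutativeMonoid M
  open CommutativeMonoidSum M
  open SetoidReasoning setoid

-- Punching a missed value out of the codomain would inject a finite set into a smaller one.
Fin-injective⇒surjective : ∀ {n} (f : Fin n → Fin n) → Injective _≡_ _≡_ f → ∀ y → ∃[ x ] f x ≡ y
Fin-injective⇒surjective {suc n} f f-injective y with Fin.any? (λ x → f x Fin.≟ y)
... | yes hit  = hit
... | no  miss = contradiction
  (Fin.injective⇒≤ {f = λ x → punchOut (y≢f x)} (λ {x} {x′} → f-injective ∘ Fin.punchOut-injective (y≢f x) (y≢f x′)))
  ℕ.1+n≰n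
  where
  y≢f : ∀ x → y ≢ f x
  y≢f x y≡fx = miss (x , ≡.sym y≡fx)

-- Serves to list the non-zero field elements. The size is `pred n` because the order of the field
-- is not literally a successor.
Fin-avoid : ∀ {n} (i : Fin n) →
            Σ[ p ∈ (Fin (ℕ.pred n) → Fin n) ] (Injective _≡_ _≡_ p × (∀ j → p j ≢ i))
Fin-avoid {suc n} i = punchIn i , (λ {j} {k} → Fin.punchIn-injective i j k) , Fin.punchInᵢ≢i i

-- Finite fields: counting arguments over all elements.

module FiniteFieldProperties {c ℓ n} (K : FiniteField c ℓ n) where

  open FieldNotions K hiding (zero)
  open CommutativeRing commutativeRing using (setoid)
  open RingProperties ring public using (-‿involutive; +-cancelʳ; -0#≈0#)
  open SemiringExp semiring public using (^-congˡ; ^-congʳ; ^-homo-*; ^-assocʳ)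
  open CommutativeSemiringExp commutativeSemiring public using (^-distrib-*)
  open SetoidReasoning setoid
  open Inverse enumeration public
    renaming (to to index; from to element; to-cong to index-cong; strictlyInverseˡ to index-element; strictlyInverseʳ to element-index)
    using ()

  index-injective : ∀ {x y} → index x ≡ index y → x ≈ y
  index-injective ix≡iy = trans (sym (element-index _)) (trans (reflexive (≡.cong element ix≡iy)) (element-index _))

  element-injective : Injective _≡_ _≈_ element
  element-injective ei≈ej = ≡.trans (≡.sym (index-element _)) (≡.trans (index-cong ei≈ej) (index-element _))

  infix 4 _≟_
  _≟_ : Decidable _≈_
  x ≟ y = map′ index-injective index-cong (index x Fin.≟ index y)

  *-inverseˡ : ∀ {x} → x ≉ 0# → x ⁻¹ * x ≈ 1#
  *-inverseˡ x≉0 = trans (*-comm _ _) (*-inverseʳ _ x≉0)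

  x⁻¹*[x*y] : ∀ {x} → x ≉ 0# → ∀ y → x ⁻¹ * (x * y) ≈ y
  x⁻¹*[x*y] x≉0 y = trans (sym (*-assoc _ _ _)) (trans (*-congʳ (*-inverseˡ x≉0)) (*-identityˡ y))

  x*[x⁻¹*y] : ∀ {x} → x ≉ 0# → ∀ y → x * (x ⁻¹ * y) ≈ y
  x*[x⁻¹*y] x≉0 y = trans (sym (*-assoc _ _ _)) (trans (*-congʳ (*-inverseʳ _ x≉0)) (*-identityˡ y))

  *-cancelˡ-≉0 : ∀ {x y z} → x ≉ 0# → x * y ≈ x * z → y ≈ z
  *-cancelˡ-≉0 {x} {y} {z} x≉0 xy≈xz = trans (sym (x⁻¹*[x*y] x≉0 y)) (trans (*-congˡ xy≈xz) (x⁻¹*[x*y] x≉0 z))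

  *-cancelˡ-≈0 : ∀ {x y} → x ≉ 0# → x * y ≈ 0# → y ≈ 0#
  *-cancelˡ-≈0 x≉0 xy≈0 = *-cancelˡ-≉0 x≉0 (trans xy≈0 (sym (zeroʳ _)))

  *-≉0 : ∀ {x y} → x ≉ 0# → y ≉ 0# → x * y ≉ 0#
  *-≉0 x≉0 y≉0 = y≉0 ∘ *-cancelˡ-≈0 x≉0

  1≉0 : 1# ≉ 0#
  1≉0 = 0≉1 ∘ sym

  ^-≉0 : ∀ {x} → x ≉ 0# → ∀ k → x ^ k ≉ 0#
  ^-≉0 x≉0 zero    = 1≉0
  ^-≉0 x≉0 (suc k) = *-≉0 x≉0 (^-≉0 x≉0 k)

  ^≈0⇒≈0 : ∀ {x} k → x ^ k ≈ 0# → x ≈ 0#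
  ^≈0⇒≈0 {x} k xᵏ≈0 with x ≟ 0#
  ... | yes x≈0 = x≈0
  ... | no  x≉0 = contradiction xᵏ≈0 (^-≉0 x≉0 k)

  1^≈1 : ∀ k → 1# ^ k ≈ 1#
  1^≈1 zero    = refl
  1^≈1 (suc k) = trans (*-identityˡ _) (1^≈1 k)

  module _ (M : CommutativeMonoid c ℓ) where
    private
      module M = CommutativeMonoid M
      open CommutativeMonoidSum M using () renaming (sum to sumᴹ; sum-permute to permute; sum-cong-≋ to sumᴹ-cong)

    -- Reindexing over all field elements, for an arbitrary commutative monoid so that it serves
    -- both sums (translation by 1) and products (multiplication by x ≠ 0).
    sum-bijection : ∀ (f : Carrier → M.Carrier) (π σ : Carrier → Carrier) →
      (∀ {x y} → x ≈ y → f x M.≈ f y) →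
      (∀ {x y} → x ≈ y → π x ≈ π y) → (∀ {x y} → x ≈ y → σ x ≈ σ y) →
      (∀ x → π (σ x) ≈ x) → (∀ x → σ (π x) ≈ x) →
      sumᴹ (f ∘ element) M.≈ sumᴹ (f ∘ π ∘ element)
    sum-bijection f π σ f-cong π-cong σ-cong πσ σπ = M.trans
      (permute (f ∘ element) (mk↔ₛ′ (index ∘ π ∘ element) (index ∘ σ ∘ element)
        (conjugate-inverse π σ π-cong πσ) (conjugate-inverse σ π σ-cong σπ)))
      (sumᴹ-cong λ i → f-cong (element-index (π (element i))))
      where
      conjugate-inverse : ∀ (π σ : Carrier → Carrier) → (∀ {x y} → x ≈ y → π x ≈ π y) →
        (∀ x → π (σ x) ≈ x) → ∀ i → index (π (element (index (σ (element i))))) ≡ i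
      conjugate-inverse π σ π-cong πσ i = ≡.trans
        (index-cong (trans (π-cong (element-index _)) (πσ _))) (index-element i)

  open SemiringMult semiring using () renaming (_×_ to _·_)

  -- Translation by 1 permutes the elements, so adding 1 to each of the n summands leaves the sum of
  -- all elements unchanged.
  order·1≈0 : n · 1# ≈ 0#
  order·1≈0 = +-cancelʳ S (n · 1#) 0# (begin
    n · 1# + S                             ≈⟨ +-congʳ (sum-replicate n) ⟨
    sumᴬ {n} (λ _ → 1#) + S                ≈⟨ ∑-distrib-+ (λ _ → 1#) element ⟨
    sumᴬ {n} (λ i → 1# + element i)        ≈⟨ sum-bijection +-commutativeMonoid (λ x → x) (1# +_) (- 1# +_)
                                               (λ x≈y → x≈y) +-congˡ +-congˡ
                                               (λ x → trans (sym (+-assoc _ _ _)) (trans (+-congʳ (-‿inverseʳ 1#)) (+-identityˡ x)))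
                                               (λ x → trans (sym (+-assoc _ _ _)) (trans (+-congʳ (-‿inverseˡ 1#)) (+-identityˡ x))) ⟨
    S                                      ≈⟨ +-identityˡ S ⟨
    0# + S                                 ∎)
    where
    open CommutativeMonoidSum +-commutativeMonoid using (sum-replicate; ∑-distrib-+) renaming (sum to sumᴬ)
    S = sumᴬ element

  -- Multiplication by x ≠ 0 permutes the elements y.  Comparing ∏ g(y) with ∏ g(x y), where
  -- g replaces 0 by 1, costs a factor x for every y ≠ 0, and h supplies the missing one.
  x^order≈x : ∀ x → x ≉ 0# → x ^ n ≈ x
  x^order≈x x x≉0 = *-cancelˡ-≉0 P≉0 (begin
    P * x ^ n                                          ≈⟨ *-comm P (x ^ n) ⟩
    x ^ n * P                                          ≈⟨ *-congʳ (sum-replicate n) ⟨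
    ∏ {n} (λ _ → x) * P                                ≈⟨ ∑-distrib-+ (λ _ → x) (g ∘ element) ⟨
    ∏ {n} (λ i → x * g (element i))                    ≈⟨ sum-cong-≋ {n} (λ i → shift (element i)) ⟨
    ∏ {n} (λ i → g (x * element i) * h (element i))    ≈⟨ ∑-distrib-+ (λ i → g (x * element i)) (h ∘ element) ⟩
    ∏ {n} (λ i → g (x * element i)) * ∏ (h ∘ element)  ≈⟨ *-cong (sym product-shift) product-h ⟩
    P * x                                              ∎)
    where
    open CommutativeMonoidSum *-commutativeMonoid using (sum-replicate; ∑-distrib-+; sum-cong-≋) renaming (sum to ∏)
    g h : Carrier → Carrier
    g y with y ≟ 0#
    ... | yes _ = 1#
    ... | no  _ = y
    h y with y ≟ 0#
    ... | yes _ = x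
    ... | no  _ = 1#

    P : Carrier
    P = ∏ (g ∘ element)

    g≉0 : ∀ y → g y ≉ 0#
    g≉0 y with y ≟ 0#
    ... | yes _   = 1≉0
    ... | no  y≉0 = y≉0

    ∏≉0 : ∀ {k} (t : Fin k → Carrier) → (∀ i → t i ≉ 0#) → ∏ t ≉ 0#
    ∏≉0 {zero}  t t≉0 = 1≉0
    ∏≉0 {suc k} t t≉0 = *-≉0 (t≉0 zero) (∏≉0 (t ∘ suc) (t≉0 ∘ suc))

    P≉0 : P ≉ 0#
    P≉0 = ∏≉0 (g ∘ element) (g≉0 ∘ element)

    g-cong : ∀ {y z} → y ≈ z → g y ≈ g z
    g-cong {y} {z} y≈z with y ≟ 0# | z ≟ 0#
    ... | yes _   | yes _   = refl
    ... | yes y≈0 | no  z≉0 = contradiction (trans (sym y≈z) y≈0) z≉0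
    ... | no  y≉0 | yes z≈0 = contradiction (trans y≈z z≈0) y≉0
    ... | no  _   | no  _   = y≈z

    shift : ∀ y → g (x * y) * h y ≈ x * g y
    shift y with y ≟ 0# | x * y ≟ 0#
    ... | yes _   | yes _    = *-comm 1# x
    ... | yes y≈0 | no  xy≉0 = contradiction (trans (*-congˡ y≈0) (zeroʳ x)) xy≉0
    ... | no  y≉0 | yes xy≈0 = contradiction xy≈0 (*-≉0 x≉0 y≉0)
    ... | no  _   | no  _    = *-identityʳ (x * y)

    product-shift : P ≈ ∏ {n} (λ i → g (x * element i))
    product-shift = sum-bijection *-commutativeMonoid g (x *_) (x ⁻¹ *_) g-cong *-congˡ *-congˡ
      (x*[x⁻¹*y] x≉0) (x⁻¹*[x*y] x≉0)

    h-zero : ∀ y → y ≈ 0# → h y ≈ x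
    h-zero y y≈0 with y ≟ 0#
    ... | yes _   = refl
    ... | no  y≉0 = contradiction y≈0 y≉0

    h-nonzero : ∀ y → y ≉ 0# → h y ≈ 1#
    h-nonzero y y≉0 with y ≟ 0#
    ... | yes y≈0 = contradiction y≈0 y≉0
    ... | no  _   = refl

    product-h : ∏ (h ∘ element) ≈ x
    product-h = trans
      (sum-single *-commutativeMonoid (h ∘ element) (index 0#)
        (λ j j≢0 → h-nonzero (element j) (λ ej≈0 → j≢0 (≡.trans (≡.sym (index-element j)) (index-cong ej≈0)))))
      (h-zero _ (element-index 0#))

  -- Roots of polynomials and exponents of the multiplicative group.

  -- Synthetic division: the quotient of `b ∷ B` by x - r has as coefficients the Horner values at r
  -- of the non-empty suffixes of `B`. It is therefore `divided-difference B r`, taken on the tail,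
  -- and is one coefficient shorter than `b ∷ B`.
  divided-difference : Polynomial → Carrier → Polynomial
  divided-difference []      r = []
  divided-difference (b ∷ B) r = eval (b ∷ B) r ∷ divided-difference B r

  length-divided-difference : ∀ B r → length (divided-difference B r) ≡ length B
  length-divided-difference []      r = ≡.refl
  length-divided-difference (b ∷ B) r = ≡.cong suc (length-divided-difference B r)

  eval-divided-difference : ∀ b B r d →
    eval (b ∷ B) (r + d) ≈ eval (b ∷ B) r + d * eval (divided-difference B r) (r + d)
  eval-divided-difference b []       r d = solve 3
    (λ b r d → b :+ (r :+ d) :* con 0 := (b :+ r :* con 0) :+ d :* con 0) refl b r d
    where open SemiringSolver commutativeSemiring
  eval-divided-difference b (b′ ∷ B) r d = trans
    (+-congˡ (*-congˡ (eval-divided-difference b′ B r d)))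
    (solve 5 (λ b r d E D → b :+ (r :+ d) :* (E :+ d :* D) := (b :+ r :* E) :+ d :* (E :+ (r :+ d) :* D)) refl
      b r d (eval (b′ ∷ B) r) (eval (divided-difference B r) (r + d)))
    where open SemiringSolver commutativeSemiring

  eval-congʳ : ∀ B {x y} → x ≈ y → eval B x ≈ eval B y
  eval-congʳ []      x≈y = refl
  eval-congʳ (b ∷ B) x≈y = +-congˡ (*-cong x≈y (eval-congʳ B x≈y))

  -- The bound on the number of roots, phrased with list length because trailing zeros leave no
  -- usable degree. Dividing by x - p(0) leaves a quotient that still vanishes at the other points.
  vanishes : ∀ {k} B (p : Fin k → Carrier) → Injective _≡_ _≈_ p → length B ℕ.≤ k →
             (∀ i → eval B (p i) ≈ 0#) → ∀ x → eval B x ≈ 0#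
  vanishes         []      p p-injective B≤k       roots x = refl
  vanishes {suc k} (b ∷ B) p p-injective (s≤s B≤k) roots x = begin
    eval (b ∷ B) x                           ≈⟨ expand x ⟩
    eval (b ∷ B) r + (x - r) * eval D x      ≈⟨ +-cong (roots zero) (*-congˡ (vanishes D (p ∘ suc) (Fin.suc-injective ∘ p-injective) D≤k D-roots x)) ⟩
    0# + (x - r) * 0#                        ≈⟨ trans (+-identityˡ _) (zeroʳ _) ⟩
    0#                                       ∎
    where
    r = p zero
    D = divided-difference B r
    D≤k = ℕ.≤-trans (ℕ.≤-reflexive (length-divided-difference B r)) B≤k
    r+[y-r]≈y : ∀ y → r + (y - r) ≈ y
    r+[y-r]≈y y = trans (+-comm _ _) (trans (+-assoc _ _ _) (trans (+-congˡ (-‿inverseˡ r)) (+-identityʳ y)))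
    expand : ∀ y → eval (b ∷ B) y ≈ eval (b ∷ B) r + (y - r) * eval D y
    expand y = begin
      eval (b ∷ B) y                                            ≈⟨ eval-congʳ (b ∷ B) (r+[y-r]≈y y) ⟨
      eval (b ∷ B) (r + (y - r))                                ≈⟨ eval-divided-difference b B r (y - r) ⟩
      eval (b ∷ B) r + (y - r) * eval D (r + (y - r))           ≈⟨ +-congˡ (*-congˡ (eval-congʳ D (r+[y-r]≈y y))) ⟩
      eval (b ∷ B) r + (y - r) * eval D y                       ∎
    D-roots : ∀ i → eval D (p (suc i)) ≈ 0#
    D-roots i = *-cancelˡ-≈0
      (λ y-r≈0 → Fin.0≢1+n (p-injective (trans (trans (sym (+-identityʳ r)) (+-congˡ (sym y-r≈0))) (r+[y-r]≈y _))))
      (begin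
        (y - r) * eval D y                   ≈⟨ +-identityˡ _ ⟨
        0# + (y - r) * eval D y              ≈⟨ +-congʳ (roots zero) ⟨
        eval (b ∷ B) r + (y - r) * eval D y  ≈⟨ expand y ⟨
        eval (b ∷ B) y                       ≈⟨ roots (suc i) ⟩
        0#                                   ∎)
      where y = p (suc i)

  eval-monomial : ∀ k x → eval (replicate k 0# ++ 1# ∷ []) x ≈ x ^ k
  eval-monomial zero    x = trans (+-congˡ (zeroʳ x)) (+-identityʳ 1#)
  eval-monomial (suc k) x = trans (+-identityˡ _) (*-congˡ (eval-monomial k x))

  -- The n - 1 non-zero elements are roots of X^(k+1) - 1, whose coefficient list has length k + 2.
  -- This replaces the existence of a primitive element.
  exponent-bound : ∀ k → (∀ x → x ≉ 0# → x ^ suc k ≈ 1#) → n ℕ.≤ suc (suc k)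
  exponent-bound k x^N≈1 with suc (suc k) ℕ.<? n
  ... | no  N+1≮n = ℕ.≮⇒≥ N+1≮n
  ... | yes N+1<n = contradiction 1≈0 1≉0
    where
    B : Polynomial
    B = - 1# ∷ replicate k 0# ++ 1# ∷ []

    length-B : length B ≡ suc (suc k)
    length-B = ≡.cong suc (≡.trans (length-++ (replicate k 0#)) (≡.trans (≡.cong (ℕ._+ 1) (length-replicate k)) (ℕ.+-comm k 1)))

    roots : ∀ x → x ≉ 0# → eval B x ≈ 0#
    roots x x≉0 = trans (+-congˡ (trans (*-congˡ (eval-monomial k x)) (x^N≈1 x x≉0))) (-‿inverseˡ 1#)

    avoid = Fin-avoid (index 0#)
    p = proj₁ avoid

    B≈0 : ∀ x → eval B x ≈ 0#
    B≈0 = vanishes B (element ∘ p) (proj₁ (proj₂ avoid) ∘ element-injective)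
      (≡.subst (ℕ._≤ ℕ.pred n) (≡.sym length-B) (ℕ.pred-mono-≤ N+1<n))
      (λ i → roots _ (λ pi≈0 → proj₂ (proj₂ avoid) i (≡.trans (≡.sym (index-element _)) (index-cong pi≈0))))

    -- The value at 0, a point outside the list of roots, is the constant coefficient -1.
    1≈0 : 1# ≈ 0#
    1≈0 = begin
      1#             ≈⟨ -‿involutive 1# ⟨
      - (- 1#)       ≈⟨ -‿cong (trans (sym (+-identityʳ _)) (trans (+-congˡ (sym (zeroˡ _))) (B≈0 0#))) ⟩
      - 0#           ≈⟨ -0#≈0# ⟩
      0#             ∎

  injective⇒permutes : ∀ f → (∀ {x y} → x ≈ y → f x ≈ f y) → (∀ {x y} → f x ≈ f y → x ≈ y) → Permutes f U
  injective⇒permutes f f-cong f-injective = _ , f-injective , surjective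
    where
    surjective : ∀ y → _
    surjective (y , _) =
      let i , fi≡y = Fin-injective⇒surjective (index ∘ f ∘ element) index-f-injective (index y)
      in (element i , _) , λ z≈ei → trans (f-cong z≈ei) (index-injective fi≡y)
      where
      index-f-injective : Injective _≡_ _≡_ (index ∘ f ∘ element)
      index-f-injective = element-injective ∘ f-injective ∘ index-injective

-- Parity, and powers of 2 modulo 3.

even⊎odd : ∀ n → (∃[ k ] n ≡ k ℕ.* 2) ⊎ (∃[ k ] n ≡ suc (k ℕ.* 2))
even⊎odd zero    = inj₁ (0 , ≡.refl)
even⊎odd (suc n) with even⊎odd n
... | inj₁ (k , n≡2k)   = inj₂ (k , ≡.cong suc n≡2k)
... | inj₂ (k , n≡1+2k) = inj₁ (suc k , ≡.cong suc n≡1+2k)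

-- Gives q ≡ 1 or q ≡ 2 modulo 3 according to the parity of m, with a quotient `i` from which the
-- exponents of cube roots are built.
4^k≡1+3i : ∀ k → ∃[ i ] 2 ℕ.^ (k ℕ.* 2) ≡ 1 ℕ.+ 3 ℕ.* i
4^k≡1+3i zero    = 0 , ≡.refl
4^k≡1+3i (suc k) with i , eq ← 4^k≡1+3i k =
  1 ℕ.+ 4 ℕ.* i , ≡.trans (≡.cong (λ e → 2 ℕ.* (2 ℕ.* e)) eq)
    (solve 1 (λ i → con 2 :* (con 2 :* (con 1 :+ con 3 :* i)) := con 1 :+ con 3 :* (con 1 :+ con 4 :* i)) ≡.refl i)
  where open +-*-Solver

-- The field with q² elements: characteristic 2, conjugation and the subfield.

module QuadraticExtension {c ℓ} (m : ℕ) (K : FiniteField c ℓ ((2 ℕ.^ m) ℕ.^ 2)) where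

  q : ℕ
  q = 2 ℕ.^ m

  open FieldNotions K hiding (zero)
  open CommutativeRing commutativeRing using (setoid)
  open FiniteFieldProperties K public
  open SetoidReasoning setoid
  open SemiringMult semiring using (×1-homo-*) renaming (_×_ to _·_)
  open CommutativeMonoidSum +-commutativeMonoid using (sum-cong-≋)

  2^k·1≈2^k : ∀ k → (2 ℕ.^ k) · 1# ≈ (1# + 1#) ^ k
  2^k·1≈2^k zero    = +-identityʳ 1#
  2^k·1≈2^k (suc k) = trans (×1-homo-* 2 (2 ℕ.^ k)) (*-cong (+-congˡ (+-identityʳ 1#)) (2^k·1≈2^k k))

  -- The order is a power of 2, so q² · 1 = 0 says that a power of 1 + 1 vanishes, and a field has
  -- no nilpotents.
  1+1≈0 : 1# + 1# ≈ 0#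
  1+1≈0 = ^≈0⇒≈0 (m ℕ.* 2) (begin
    (1# + 1#) ^ (m ℕ.* 2)          ≈⟨ 2^k·1≈2^k (m ℕ.* 2) ⟨
    (2 ℕ.^ (m ℕ.* 2)) · 1#         ≡⟨ ≡.cong (_· 1#) (ℕ.^-*-assoc 2 m 2) ⟨
    (q ℕ.^ 2) · 1#                 ≈⟨ order·1≈0 ⟩
    0#                             ∎)

  x+x≈0 : ∀ x → x + x ≈ 0#
  x+x≈0 x = begin
    x + x              ≈⟨ +-cong (*-identityˡ x) (*-identityˡ x) ⟨
    1# * x + 1# * x    ≈⟨ distribʳ x 1# 1# ⟨
    (1# + 1#) * x      ≈⟨ *-congʳ 1+1≈0 ⟩
    0# * x             ≈⟨ zeroˡ x ⟩
    0#                 ∎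

  ≈⇒+≈0 : ∀ {x y} → x ≈ y → x + y ≈ 0#
  ≈⇒+≈0 x≈y = trans (+-congʳ x≈y) (x+x≈0 _)

  +≈0⇒≈ : ∀ {x y} → x + y ≈ 0# → x ≈ y
  +≈0⇒≈ {x} {y} x+y≈0 = +-cancelʳ y x y (trans x+y≈0 (sym (x+x≈0 y)))

  -- The solver works over the coefficient ring 𝔽₂, so it decides polynomial identities
  -- in characteristic 2.
  private
    𝔽₂⟶K : CommutativeRing.rawRing xor-∧-commutativeRing -Raw-AlmostCommutative⟶ fromCommutativeRing commutativeRing
    𝔽₂⟶K = record
      { ⟦_⟧    = λ { false → 0# ; true → 1# }
      ; +-homo = λ { false _ → sym (+-identityˡ _) ; true false → sym (+-identityʳ 1#) ; true true → sym 1+1≈0 }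
      ; *-homo = λ { false _ → sym (zeroˡ _) ; true _ → sym (*-identityˡ _) }
      ; -‿homo = λ { false → sym -0#≈0# ; true → trans (sym (+-identityʳ 1#)) (trans (+-congˡ (sym (-‿inverseʳ 1#)))
                    (trans (sym (+-assoc 1# 1# _)) (trans (+-congʳ 1+1≈0) (+-identityˡ _)))) }
      ; 0-homo = refl
      ; 1-homo = refl
      }

    _coeff≟_ : ∀ x y → Maybe (_-Raw-AlmostCommutative⟶_.⟦_⟧ 𝔽₂⟶K x ≈ _-Raw-AlmostCommutative⟶_.⟦_⟧ 𝔽₂⟶K y)
    false coeff≟ false = just refl
    true  coeff≟ true  = just refl
    false coeff≟ true  = nothing
    true  coeff≟ false = nothing

  open RingSolver (CommutativeRing.rawRing xor-∧-commutativeRing) (fromCommutativeRing commutativeRing) 𝔽₂⟶K _coeff≟_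
    using (solve; con; _:+_; _:*_; _:^_; _:=_) public

  ^2-+ : ∀ x y → (x + y) ^ 2 ≈ x ^ 2 + y ^ 2
  ^2-+ = solve 2 (λ x y → (x :+ y) :^ 2 := x :^ 2 :+ y :^ 2) refl

  ^-comm : ∀ x j k → (x ^ j) ^ k ≈ (x ^ k) ^ j
  ^-comm x j k = trans (^-assocʳ x j k) (trans (^-congʳ x (ℕ.*-comm j k)) (sym (^-assocʳ x k j)))

  ^2^-+ : ∀ k x y → (x + y) ^ (2 ℕ.^ k) ≈ x ^ (2 ℕ.^ k) + y ^ (2 ℕ.^ k)
  ^2^-+ zero    x y = trans (*-identityʳ _) (sym (+-cong (*-identityʳ x) (*-identityʳ y)))
  ^2^-+ (suc k) x y = begin
    (x + y) ^ (2 ℕ.* 2 ℕ.^ k)                             ≈⟨ ^-assocʳ (x + y) 2 (2 ℕ.^ k) ⟨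
    ((x + y) ^ 2) ^ (2 ℕ.^ k)                             ≈⟨ ^-congˡ (2 ℕ.^ k) (^2-+ x y) ⟩
    (x ^ 2 + y ^ 2) ^ (2 ℕ.^ k)                           ≈⟨ ^2^-+ k (x ^ 2) (y ^ 2) ⟩
    (x ^ 2) ^ (2 ℕ.^ k) + (y ^ 2) ^ (2 ℕ.^ k)             ≈⟨ +-cong (^-assocʳ x 2 (2 ℕ.^ k)) (^-assocʳ y 2 (2 ℕ.^ k)) ⟩
    x ^ (2 ℕ.* 2 ℕ.^ k) + y ^ (2 ℕ.* 2 ℕ.^ k)             ∎

  0^≈0 : ∀ {k} → k ℕ.> 0 → 0# ^ k ≈ 0#
  0^≈0 (s≤s _) = zeroˡ _

  q>0 : q ℕ.> 0
  q>0 = ℕ.m^n>0 2 m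

  conj-+ : ∀ x y → (x + y) ^ q ≈ x ^ q + y ^ q
  conj-+ = ^2^-+ m

  conj-* : ∀ x y → (x * y) ^ q ≈ x ^ q * y ^ q
  conj-* x y = ^-distrib-* x y q

  conj-involutive : ∀ x → (x ^ q) ^ q ≈ x
  conj-involutive x with x ≟ 0#
  ... | yes x≈0 = begin
    (x ^ q) ^ q      ≈⟨ ^-congˡ q (^-congˡ q x≈0) ⟩
    (0# ^ q) ^ q     ≈⟨ ^-congˡ q (0^≈0 q>0) ⟩
    0# ^ q           ≈⟨ 0^≈0 q>0 ⟩
    0#               ≈⟨ x≈0 ⟨
    x                ∎
  ... | no  x≉0 = begin
    (x ^ q) ^ q          ≈⟨ ^-assocʳ x q q ⟩
    x ^ (q ℕ.* q)        ≈⟨ ^-congʳ x (≡.cong (q ℕ.*_) (≡.sym (ℕ.*-identityʳ q))) ⟩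
    x ^ (q ℕ.^ 2)        ≈⟨ x^order≈x x x≉0 ⟩
    x                    ∎

  𝔽-+ : ∀ {x y} → x ∈ 𝔽 q → y ∈ 𝔽 q → x + y ∈ 𝔽 q
  𝔽-+ x∈𝔽 y∈𝔽 = trans (conj-+ _ _) (+-cong x∈𝔽 y∈𝔽)

  𝔽-* : ∀ {x y} → x ∈ 𝔽 q → y ∈ 𝔽 q → x * y ∈ 𝔽 q
  𝔽-* x∈𝔽 y∈𝔽 = trans (conj-* _ _) (*-cong x∈𝔽 y∈𝔽)

  𝔽-^ : ∀ {x} k → x ∈ 𝔽 q → x ^ k ∈ 𝔽 q
  𝔽-^ k x∈𝔽 = trans (^-comm _ k q) (^-congˡ k x∈𝔽)

  𝔽-⁻¹ : ∀ {x} → x ≉ 0# → x ∈ 𝔽 q → x ⁻¹ ∈ 𝔽 q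
  𝔽-⁻¹ {x} x≉0 x∈𝔽 = *-cancelˡ-≉0 x≉0 (begin
    x * (x ⁻¹) ^ q          ≈⟨ *-congʳ x∈𝔽 ⟨
    x ^ q * (x ⁻¹) ^ q      ≈⟨ conj-* x (x ⁻¹) ⟨
    (x * x ⁻¹) ^ q          ≈⟨ ^-congˡ q (*-inverseʳ x x≉0) ⟩
    1# ^ q                  ≈⟨ 1^≈1 q ⟩
    1#                      ≈⟨ *-inverseʳ x x≉0 ⟨
    x * x ⁻¹                ∎)

  𝔽-cong : ∀ {x y} → x ≈ y → x ∈ 𝔽 q → y ∈ 𝔽 q
  𝔽-cong x≈y x∈𝔽 = trans (^-congˡ q (sym x≈y)) (trans x∈𝔽 x≈y)

  x+xᑫ∈𝔽 : ∀ x → x + x ^ q ∈ 𝔽 q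
  x+xᑫ∈𝔽 x = trans (conj-+ x (x ^ q)) (trans (+-congˡ (conj-involutive x)) (+-comm _ _))

  x*xᑫ∈𝔽 : ∀ x → x * x ^ q ∈ 𝔽 q
  x*xᑫ∈𝔽 x = trans (conj-* x (x ^ q)) (trans (*-congˡ (conj-involutive x)) (*-comm _ _))

  ∉𝔽⇒x+xᑫ≉0 : ∀ {x} → x ∉ 𝔽 q → x + x ^ q ≉ 0#
  ∉𝔽⇒x+xᑫ≉0 x∉𝔽 = x∉𝔽 ∘ sym ∘ +≈0⇒≈

  -- The absolute trace and Artin–Schreier equations

  Tr-cong : ∀ k {x y} → x ≈ y → Tr k x ≈ Tr k y
  Tr-cong k x≈y = sum-cong-≋ {k} (λ i → ^-congˡ (2 ℕ.^ toℕ i) x≈y)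

  Tr-suc : ∀ k x → Tr (suc k) x ≈ x + Tr k (x ^ 2)
  Tr-suc k x = +-cong (*-identityʳ x) (sum-cong-≋ {k} (λ i → sym (^-assocʳ x 2 (2 ℕ.^ toℕ i))))

  Tr-+ : ∀ k x y → Tr k (x + y) ≈ Tr k x + Tr k y
  Tr-+ zero    x y = sym (+-identityʳ 0#)
  Tr-+ (suc k) x y = begin
    Tr (suc k) (x + y)                               ≈⟨ Tr-suc k (x + y) ⟩
    x + y + Tr k ((x + y) ^ 2)                       ≈⟨ +-congˡ (trans (Tr-cong k (^2-+ x y)) (Tr-+ k (x ^ 2) (y ^ 2))) ⟩
    x + y + (Tr k (x ^ 2) + Tr k (y ^ 2))            ≈⟨ solve 4 (λ x y X Y → x :+ y :+ (X :+ Y) := (x :+ X) :+ (y :+ Y)) refl x y _ _ ⟩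
    (x + Tr k (x ^ 2)) + (y + Tr k (y ^ 2))          ≈⟨ +-cong (Tr-suc k x) (Tr-suc k y) ⟨
    Tr (suc k) x + Tr (suc k) y                      ∎

  Tr-^2 : ∀ k x → Tr k (x ^ 2) ≈ Tr k x ^ 2
  Tr-^2 zero    x = sym (zeroˡ _)
  Tr-^2 (suc k) x = begin
    Tr (suc k) (x ^ 2)                    ≈⟨ Tr-suc k (x ^ 2) ⟩
    x ^ 2 + Tr k ((x ^ 2) ^ 2)            ≈⟨ +-congˡ (Tr-^2 k (x ^ 2)) ⟩
    x ^ 2 + Tr k (x ^ 2) ^ 2              ≈⟨ ^2-+ x (Tr k (x ^ 2)) ⟨
    (x + Tr k (x ^ 2)) ^ 2                ≈⟨ ^-congˡ 2 (Tr-suc k x) ⟨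
    Tr (suc k) x ^ 2                      ∎

  Tr-suc-square : ∀ k x → Tr (suc k) x ≈ x + Tr k x ^ 2
  Tr-suc-square k x = trans (Tr-suc k x) (+-congˡ (Tr-^2 k x))

  -- The sum telescopes. For k = m the right side is w^q + w, so the trace of w² + w measures how
  -- far w is from the subfield.
  Tr-w²+w : ∀ k w → Tr k (w ^ 2 + w) ≈ w ^ (2 ℕ.^ k) + w
  Tr-w²+w zero    w = sym (trans (+-congʳ (*-identityʳ w)) (x+x≈0 w))
  Tr-w²+w (suc k) w = begin
    Tr (suc k) (w ^ 2 + w)                                  ≈⟨ Tr-suc k (w ^ 2 + w) ⟩
    w ^ 2 + w + Tr k ((w ^ 2 + w) ^ 2)                      ≈⟨ +-congˡ (trans (Tr-cong k (^2-+ (w ^ 2) w)) (Tr-w²+w k (w ^ 2))) ⟩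
    w ^ 2 + w + ((w ^ 2) ^ (2 ℕ.^ k) + w ^ 2)               ≈⟨ solve 2 (λ w v → w :^ 2 :+ w :+ (v :+ w :^ 2) := v :+ w) refl w _ ⟩
    (w ^ 2) ^ (2 ℕ.^ k) + w                                 ≈⟨ +-congʳ (^-assocʳ w 2 (2 ℕ.^ k)) ⟩
    w ^ (2 ℕ.^ suc k) + w                                   ∎

  -- The recursion splits off the first term; telescoping Tr(x² + x) converts this into splitting
  -- off the last.
  Tr-suc-last : ∀ k x → Tr (suc k) x ≈ Tr k x + x ^ (2 ℕ.^ k)
  Tr-suc-last k x = begin
    Tr (suc k) x                          ≈⟨ Tr-suc-square k x ⟩
    x + Tr k x ^ 2                        ≈⟨ solve 2 (λ x T → x :+ T :^ 2 := T :+ (T :^ 2 :+ T :+ x)) refl x (Tr k x) ⟩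
    Tr k x + (Tr k x ^ 2 + Tr k x + x)    ≈⟨ +-congˡ (+-congʳ (trans (+-congʳ (sym (Tr-^2 k x))) (trans (sym (Tr-+ k (x ^ 2) x)) (Tr-w²+w k x)))) ⟩
    Tr k x + (x ^ (2 ℕ.^ k) + x + x)      ≈⟨ +-congˡ (trans (+-assoc _ _ _) (trans (+-congˡ (x+x≈0 x)) (+-identityʳ _))) ⟩
    Tr k x + x ^ (2 ℕ.^ k)                ∎

  abstract
    -- T² + T = Tr(x² + x) = x^q + x = 0 for T = Tr x.
    Tr≈0⊎Tr≈1 : ∀ {x} → x ∈ 𝔽 q → Tr m x ≈ 0# ⊎ Tr m x ≈ 1#
    Tr≈0⊎Tr≈1 {x} x∈𝔽 with Tr m x ≟ 0#
    ... | yes T≈0 = inj₁ T≈0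
    ... | no  T≉0 = inj₂ (+≈0⇒≈ (*-cancelˡ-≈0 T≉0 (begin
      T * (T + 1#)             ≈⟨ solve 1 (λ T → T :* (T :+ con true) := T :^ 2 :+ T) refl T ⟩
      T ^ 2 + T                ≈⟨ +-congʳ (Tr-^2 m x) ⟨
      Tr m (x ^ 2) + T         ≈⟨ Tr-+ m (x ^ 2) x ⟨
      Tr m (x ^ 2 + x)         ≈⟨ Tr-w²+w m x ⟩
      x ^ q + x                ≈⟨ ≈⇒+≈0 x∈𝔽 ⟩
      0#                       ∎)))
      where
      T : Carrier
      T = Tr m x

  Tr-1-even : ∀ k → Tr (k ℕ.* 2) 1# ≈ 0#
  Tr-1-even zero    = refl
  Tr-1-even (suc k) = begin
    Tr (suc (suc (k ℕ.* 2))) 1#            ≈⟨ Tr-suc-square (suc (k ℕ.* 2)) 1# ⟩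
    1# + Tr (suc (k ℕ.* 2)) 1# ^ 2         ≈⟨ +-congˡ (^-congˡ 2 (Tr-suc-square (k ℕ.* 2) 1#)) ⟩
    1# + (1# + Tr (k ℕ.* 2) 1# ^ 2) ^ 2    ≈⟨ +-congˡ (^-congˡ 2 (+-congˡ (^-congˡ 2 (Tr-1-even k)))) ⟩
    1# + (1# + 0# ^ 2) ^ 2                 ≈⟨ solve 0 (con true :+ (con true :+ con false :^ 2) :^ 2 := con false) refl ⟩
    0#                                     ∎

  Tr-1-odd : ∀ k → Tr (suc (k ℕ.* 2)) 1# ≈ 1#
  Tr-1-odd k = begin
    Tr (suc (k ℕ.* 2)) 1#       ≈⟨ Tr-suc-square (k ℕ.* 2) 1# ⟩
    1# + Tr (k ℕ.* 2) 1# ^ 2    ≈⟨ +-congˡ (trans (^-congˡ 2 (Tr-1-even k)) (zeroˡ _)) ⟩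
    1# + 0#                     ≈⟨ +-identityʳ 1# ⟩
    1#                          ∎

  -- The partial sums of the additive form of Hilbert 90:
  -- hilbert90 c τ k = Σ_{i<k} (Σ_{j<i} c^(2^j)) τ^(2^i).
  hilbert90 : Carrier → Carrier → ℕ → Carrier
  hilbert90 c τ zero    = 0#
  hilbert90 c τ (suc k) = hilbert90 c τ k + Tr k c * τ ^ (2 ℕ.^ k)

  -- Kept general in k for the induction. At k = m, with Tr τ = 1 and Tr c = 0, the boundary term
  -- disappears and the right side is c.
  hilbert90-w²+w : ∀ c τ k → hilbert90 c τ k ^ 2 + hilbert90 c τ k ≈ c * Tr k τ ^ 2 + Tr k c * τ ^ (2 ℕ.^ k)
  hilbert90-w²+w c τ zero    = solve 2 (λ c t → con false :^ 2 :+ con false := c :* con false :^ 2 :+ con false :* t) refl c _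
  hilbert90-w²+w c τ (suc k) = begin
    (W + S * t) ^ 2 + (W + S * t)              ≈⟨ solve 3 (λ W S t → (W :+ S :* t) :^ 2 :+ (W :+ S :* t) := (W :^ 2 :+ W) :+ ((S :* t) :^ 2 :+ S :* t)) refl W S t ⟩
    (W ^ 2 + W) + ((S * t) ^ 2 + S * t)        ≈⟨ +-congʳ (hilbert90-w²+w c τ k) ⟩
    (c * T ^ 2 + S * t) + ((S * t) ^ 2 + S * t)
      ≈⟨ solve 4 (λ c T S t → (c :* T :^ 2 :+ S :* t) :+ ((S :* t) :^ 2 :+ S :* t)
                           := c :* (T :+ t) :^ 2 :+ (c :+ S :^ 2) :* t :^ 2) refl c T S t ⟩
    c * (T + t) ^ 2 + (c + S ^ 2) * t ^ 2      ≈⟨ +-cong (*-congˡ (^-congˡ 2 (Tr-suc-last k τ))) (*-cong (Tr-suc-square k c) t²) ⟨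
    c * Tr (suc k) τ ^ 2 + Tr (suc k) c * τ ^ (2 ℕ.^ suc k)   ∎
    where
    W = hilbert90 c τ k
    S = Tr k c
    T = Tr k τ
    t = τ ^ (2 ℕ.^ k)
    t² : τ ^ (2 ℕ.^ suc k) ≈ t ^ 2
    t² = trans (^-congʳ τ (ℕ.*-comm 2 (2 ℕ.^ k))) (sym (^-assocʳ τ (2 ℕ.^ k) 2))

  module TraceOne {a} (a∉𝔽 : a ∉ 𝔽 q) where

    -- Normalising a by its relative trace gives θ^q = θ + 1, so τ has absolute trace 1 and comes
    -- with an explicit solution θ of w² + w = τ.
    θ τ : Carrier
    θ = a * (a + a ^ q) ⁻¹
    τ = θ ^ 2 + θ

    θᑫ+θ≈1 : θ ^ q + θ ≈ 1#
    θᑫ+θ≈1 = begin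
      (a * T ⁻¹) ^ q + a * T ⁻¹     ≈⟨ +-congʳ (trans (conj-* a (T ⁻¹)) (*-congˡ (𝔽-⁻¹ T≉0 (x+xᑫ∈𝔽 a)))) ⟩
      a ^ q * T ⁻¹ + a * T ⁻¹       ≈⟨ solve 3 (λ a a′ t → a′ :* t :+ a :* t := (a :+ a′) :* t) refl a (a ^ q) (T ⁻¹) ⟩
      T * T ⁻¹                      ≈⟨ *-inverseʳ T T≉0 ⟩
      1#                            ∎
      where
      T = a + a ^ q
      T≉0 = ∉𝔽⇒x+xᑫ≉0 a∉𝔽

    Tr-τ≈1 : Tr m τ ≈ 1#
    Tr-τ≈1 = trans (Tr-w²+w m θ) θᑫ+θ≈1

    solve-trace-0 : ∀ c → Tr m c ≈ 0# → hilbert90 c τ m ^ 2 + hilbert90 c τ m ≈ c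
    solve-trace-0 c Tr-c≈0 = begin
      hilbert90 c τ m ^ 2 + hilbert90 c τ m     ≈⟨ hilbert90-w²+w c τ m ⟩
      c * Tr m τ ^ 2 + Tr m c * τ ^ q           ≈⟨ +-cong (*-congˡ (^-congˡ 2 Tr-τ≈1)) (*-congʳ Tr-c≈0) ⟩
      c * 1# ^ 2 + 0# * τ ^ q                   ≈⟨ solve 2 (λ c t → c :* con true :^ 2 :+ con false :* t := c) refl c (τ ^ q) ⟩
      c                                         ∎

  abstract
    -- If Tr c = 1, then c + τ has trace 0 and is solved inside Hilbert 90; adding θ to that
    -- solution undoes the shift by τ.
    w²+w-solve : ∀ {a c} → a ∉ 𝔽 q → c ∈ 𝔽 q → ∃[ w ] w ^ 2 + w ≈ c
    w²+w-solve {a} {c} a∉𝔽 c∈𝔽 with Tr≈0⊎Tr≈1 c∈𝔽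
    ... | inj₁ Tr-c≈0 = hilbert90 c τ m , solve-trace-0 c Tr-c≈0
      where open TraceOne a∉𝔽
    ... | inj₂ Tr-c≈1 = hilbert90 (c + τ) τ m + θ , (begin
      (W + θ) ^ 2 + (W + θ)              ≈⟨ solve 2 (λ W θ → (W :+ θ) :^ 2 :+ (W :+ θ) := (W :^ 2 :+ W) :+ (θ :^ 2 :+ θ)) refl W θ ⟩
      (W ^ 2 + W) + τ                    ≈⟨ +-congʳ (solve-trace-0 (c + τ) (trans (Tr-+ m c τ) (≈⇒+≈0 (trans Tr-c≈1 (sym Tr-τ≈1))))) ⟩
      c + τ + τ                          ≈⟨ solve 2 (λ c τ → c :+ τ :+ τ := c) refl c τ ⟩
      c                                  ∎)
      where
      open TraceOne a∉𝔽
      W : Carrier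
      W = hilbert90 (c + τ) τ m

  -- Quadratics and cubics over the subfield

  -- The exponent 2q - 1 is written without subtraction. It is chosen because 3 divides it when m is
  -- odd, which yields cube roots as powers.
  u^[2q-1]≈u : ∀ {u k} → suc k ≡ q ℕ.* 2 → u ≉ 0# → u ∈ 𝔽 q → u ^ k ≈ u
  u^[2q-1]≈u {u} {k} 1+k≡2q u≉0 u∈𝔽 = *-cancelˡ-≉0 u≉0 (begin
    u ^ suc k           ≈⟨ ^-congʳ u 1+k≡2q ⟩
    u ^ (q ℕ.* 2)       ≈⟨ ^-assocʳ u q 2 ⟨
    (u ^ q) ^ 2         ≈⟨ ^-congˡ 2 u∈𝔽 ⟩
    u ^ 2               ≈⟨ *-congˡ (*-identityʳ u) ⟩
    u * u               ∎)

  module QuadraticRoots {β γ d} (β∈𝔽 : β ∈ 𝔽 q) (β≉0 : β ≉ 0#) (dβ²≈γ : d * β ^ 2 ≈ γ) where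

    -- With u = β w the equation becomes w² + w = d, and telescoping gives w^q + w = Tr d.
    -- Conjugation thus fixes u or moves it to the other root u + β according to the trace.
    root-conj : ∀ {u} → u ^ 2 + β * u + γ ≈ 0# → u ^ q ≈ u + β * Tr m d
    root-conj {u} root = begin
      u ^ q                          ≈⟨ ^-congˡ q u≈βw ⟩
      (β * w) ^ q                    ≈⟨ trans (conj-* β w) (*-congʳ β∈𝔽) ⟩
      β * w ^ q                      ≈⟨ solve 3 (λ β w v → β :* v := β :* w :+ β :* (v :+ w)) refl β w (w ^ q) ⟩
      β * w + β * (w ^ q + w)        ≈⟨ +-cong (sym u≈βw) (*-congˡ (trans (sym (Tr-w²+w m w)) (Tr-cong m w²+w≈d))) ⟩
      u + β * Tr m d                 ∎
      where
      w = β ⁻¹ * u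
      u≈βw : u ≈ β * w
      u≈βw = sym (x*[x⁻¹*y] β≉0 u)
      w²+w≈d : w ^ 2 + w ≈ d
      w²+w≈d = *-cancelˡ-≉0 (^-≉0 β≉0 2) (begin
        β ^ 2 * (w ^ 2 + w)              ≈⟨ solve 2 (λ β w → β :^ 2 :* (w :^ 2 :+ w) := (β :* w) :^ 2 :+ β :* (β :* w)) refl β w ⟩
        (β * w) ^ 2 + β * (β * w)        ≈⟨ +-cong (^-congˡ 2 (sym u≈βw)) (*-congˡ (sym u≈βw)) ⟩
        u ^ 2 + β * u                    ≈⟨ +≈0⇒≈ root ⟩
        γ                                ≈⟨ dβ²≈γ ⟨
        d * β ^ 2                        ≈⟨ *-comm d (β ^ 2) ⟩
        β ^ 2 * d                        ∎)

    root-exists : ∀ {a} → a ∉ 𝔽 q → d ∈ 𝔽 q → ∃[ u ] u ^ 2 + β * u + γ ≈ 0#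
    root-exists a∉𝔽 d∈𝔽 = let w , w²+w≈d = w²+w-solve a∉𝔽 d∈𝔽 in β * w , (begin
      (β * w) ^ 2 + β * (β * w) + γ     ≈⟨ solve 3 (λ β w γ → (β :* w) :^ 2 :+ β :* (β :* w) :+ γ := (w :^ 2 :+ w) :* β :^ 2 :+ γ) refl β w γ ⟩
      (w ^ 2 + w) * β ^ 2 + γ           ≈⟨ ≈⇒+≈0 (trans (*-congʳ w²+w≈d) dβ²≈γ) ⟩
      0#                                ∎)

  cubic resolvent : Carrier → Carrier → Carrier → Carrier
  cubic α β x = x ^ 3 + α * x + β
  resolvent α β u = u ^ 2 + β * u + α ^ 3

  cubic-cong : ∀ {α α′ β β′ x x′} → α ≈ α′ → β ≈ β′ → x ≈ x′ → cubic α β x ≈ cubic α′ β′ x′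
  cubic-cong α≈ β≈ x≈ = +-cong (+-cong (^-congˡ 3 x≈) (*-cong α≈ x≈)) β≈

  resolvent-cong : ∀ {α α′ β β′ u u′} → α ≈ α′ → β ≈ β′ → u ≈ u′ → resolvent α β u ≈ resolvent α′ β′ u′
  resolvent-cong α≈ β≈ u≈ = +-cong (+-cong (^-congˡ 2 u≈) (*-cong β≈ u≈)) (^-congˡ 3 α≈)

  -- Cardano's substitution x = y + α / y, with y′ = α / y.
  resolvent-cubic : ∀ {α y y′} β → y * y′ ≈ α → resolvent α β (y ^ 3) ≈ y ^ 3 * cubic α β (y + y′)
  resolvent-cubic {α} {y} {y′} β yy′≈α = begin
    resolvent α β (y ^ 3)                     ≈⟨ resolvent-cong yy′≈α refl refl ⟨
    resolvent (y * y′) β (y ^ 3)              ≈⟨ solve 3 (λ y z β → (y :^ 3) :^ 2 :+ β :* y :^ 3 :+ (y :* z) :^ 3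
                                                  := y :^ 3 :* ((y :+ z) :^ 3 :+ (y :* z) :* (y :+ z) :+ β)) refl y y′ β ⟩
    y ^ 3 * cubic (y * y′) β (y + y′)         ≈⟨ *-congˡ (cubic-cong yy′≈α refl refl) ⟩
    y ^ 3 * cubic α β (y + y′)                ∎

  NonCube : Carrier → Set _
  NonCube u = (2 ∣ m → ¬ IsCubeIn (𝔽 q) u) × (2 ∤ m → ¬ IsCubeIn U u)

  -- Roots of x³ + α x + β in the subfield; `d` stands for α³/β².

  module CubicCriterion {a α β d} (a∉𝔽 : a ∉ 𝔽 q) (α∈𝔽 : α ∈ 𝔽 q) (β∈𝔽 : β ∈ 𝔽 q)
    (α≉0 : α ≉ 0#) (β≉0 : β ≉ 0#) (dβ²≈α³ : d * β ^ 2 ≈ α ^ 3) where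

    open QuadraticRoots β∈𝔽 β≉0 dβ²≈α³

    d∈𝔽 : d ∈ 𝔽 q
    d∈𝔽 = *-cancelˡ-≉0 (^-≉0 β≉0 2) (begin
      β ^ 2 * d ^ q          ≈⟨ *-congʳ (𝔽-^ 2 β∈𝔽) ⟨
      (β ^ 2) ^ q * d ^ q    ≈⟨ conj-* (β ^ 2) d ⟨
      (β ^ 2 * d) ^ q        ≈⟨ 𝔽-cong (sym (trans (*-comm _ _) dβ²≈α³)) (𝔽-^ 3 α∈𝔽) ⟩
      β ^ 2 * d              ∎)

    resolvent-root≉0 : ∀ {u} → resolvent α β u ≈ 0# → u ≉ 0#
    resolvent-root≉0 {u} root u≈0 = ^-≉0 α≉0 3 (begin
      α ^ 3                              ≈⟨ solve 2 (λ α β → α :^ 3 := con false :^ 2 :+ β :* con false :+ α :^ 3) refl α β ⟩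
      resolvent α β 0#                   ≈⟨ resolvent-cong refl refl u≈0 ⟨
      resolvent α β u                    ≈⟨ root ⟩
      0#                                 ∎)

    factor≉0 : ∀ {y y′} → y * y′ ≈ α → y ≉ 0#
    factor≉0 yy′≈α y≈0 = α≉0 (trans (sym yy′≈α) (trans (*-congʳ y≈0) (zeroˡ _)))

    cubic-root : ∀ {y y′} → y * y′ ≈ α → resolvent α β (y ^ 3) ≈ 0# → cubic α β (y + y′) ≈ 0#
    cubic-root yy′≈α root = *-cancelˡ-≈0 (^-≉0 (factor≉0 yy′≈α) 3) (trans (sym (resolvent-cubic β yy′≈α)) root)

    cubic-root-𝔽 : ∀ {y} → y ∈ 𝔽 q → resolvent α β (y ^ 3) ≈ 0# → ∃[ x ] (x ∈ 𝔽 q × cubic α β x ≈ 0#)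
    cubic-root-𝔽 {y} y∈𝔽 root = y + y ⁻¹ * α ,
      𝔽-+ y∈𝔽 (𝔽-* (𝔽-⁻¹ y≉0 y∈𝔽) α∈𝔽) , cubic-root (x*[x⁻¹*y] y≉0 α) root
      where
      y≉0 : y ≉ 0#
      y≉0 = resolvent-root≉0 root ∘ λ y≈0 → trans (^-congˡ 3 y≈0) (zeroˡ _)

    -- If y has norm α, then α / y is its conjugate, so Cardano's x is the relative trace of y and
    -- lies in the subfield even when y does not.
    cubic-root-norm : ∀ {y} → y * y ^ q ≈ α → resolvent α β (y ^ 3) ≈ 0# → ∃[ x ] (x ∈ 𝔽 q × cubic α β x ≈ 0#)
    cubic-root-norm {y} yyᑫ≈α root = y + y ^ q , x+xᑫ∈𝔽 y , cubic-root yyᑫ≈α root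

    -- For trace 1 the conjugate of u is the other root of the resolvent, so the norm of u is the
    -- product of the roots.
    norm-root : ∀ {u} → Tr m d ≈ 1# → resolvent α β u ≈ 0# → u * u ^ q ≈ α ^ 3
    norm-root {u} Tr≈1 root = begin
      u * u ^ q                  ≈⟨ *-congˡ (root-conj root) ⟩
      u * (u + β * Tr m d)       ≈⟨ *-congˡ (+-congˡ (*-congˡ Tr≈1)) ⟩
      u * (u + β * 1#)           ≈⟨ solve 2 (λ u β → u :* (u :+ β :* con true) := u :^ 2 :+ β :* u) refl u β ⟩
      u ^ 2 + β * u              ≈⟨ +≈0⇒≈ root ⟩
      α ^ 3                      ∎

    fixed-root : ∀ {u} → Tr m d ≈ 0# → resolvent α β u ≈ 0# → u ∈ 𝔽 q
    fixed-root {u} Tr≈0 root = trans (root-conj root)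
      (trans (+-congˡ (trans (*-congˡ Tr≈0) (zeroʳ β))) (+-identityʳ u))

    -- Since u^(q+2) = u · u^(q+1) = u α³, the element u^j / α with 3j = q + 2 is a cube root of u.
    -- Its norm is α^(3j) / α² = α^q = α, as `cubic-root-norm` requires.
    reducible-trace-1 : ∀ {u} j → j ℕ.* 3 ≡ suc (suc q) → Tr m d ≈ 1# → resolvent α β u ≈ 0# →
                        ∃[ x ] (x ∈ 𝔽 q × cubic α β x ≈ 0#)
    reducible-trace-1 {u} j j*3≡q+2 Tr≈1 root = cubic-root-norm yyᑫ≈α (trans (resolvent-cong refl refl y³≈u) root)
      where
      y : Carrier
      y = α ⁻¹ * u ^ j
      αy≈uʲ : α * y ≈ u ^ j
      αy≈uʲ = x*[x⁻¹*y] α≉0 (u ^ j)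
      y³≈u : y ^ 3 ≈ u
      y³≈u = *-cancelˡ-≉0 (^-≉0 α≉0 3) (begin
        α ^ 3 * y ^ 3           ≈⟨ ^-distrib-* α y 3 ⟨
        (α * y) ^ 3             ≈⟨ ^-congˡ 3 αy≈uʲ ⟩
        (u ^ j) ^ 3             ≈⟨ trans (^-assocʳ u j 3) (^-congʳ u j*3≡q+2) ⟩
        u * (u * u ^ q)         ≈⟨ *-congˡ (norm-root Tr≈1 root) ⟩
        u * α ^ 3               ≈⟨ *-comm u (α ^ 3) ⟩
        α ^ 3 * u               ∎)
      yyᑫ≈α : y * y ^ q ≈ α
      yyᑫ≈α = *-cancelˡ-≉0 (*-≉0 α≉0 α≉0) (begin
        α * α * (y * y ^ q)              ≈⟨ solve 3 (λ α y z → α :* α :* (y :* z) := (α :* y) :* (α :* z)) refl α y (y ^ q) ⟩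
        (α * y) * (α * y ^ q)            ≈⟨ *-congˡ (trans (*-congʳ (sym α∈𝔽)) (sym (conj-* α y))) ⟩
        (α * y) * (α * y) ^ q            ≈⟨ *-cong αy≈uʲ (^-congˡ q αy≈uʲ) ⟩
        u ^ j * (u ^ j) ^ q              ≈⟨ *-congˡ (^-comm u j q) ⟩
        u ^ j * (u ^ q) ^ j              ≈⟨ ^-distrib-* u (u ^ q) j ⟨
        (u * u ^ q) ^ j                  ≈⟨ ^-congˡ j (norm-root Tr≈1 root) ⟩
        (α ^ 3) ^ j                      ≈⟨ trans (^-comm α 3 j) (trans (^-assocʳ α j 3) (^-congʳ α j*3≡q+2)) ⟩
        α * (α * α ^ q)                  ≈⟨ *-congˡ (*-congˡ α∈𝔽) ⟩
        α * (α * α)                      ≈⟨ *-assoc α α α ⟨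
        α * α * α                        ∎)

    3∣q+2 : ∀ k → m ≡ k ℕ.* 2 → ∃[ j ] j ℕ.* 3 ≡ suc (suc q)
    3∣q+2 k m≡2k = suc i , ≡.trans (rearrange i)
      (≡.cong (2 ℕ.+_) (≡.sym (≡.trans (≡.cong (2 ℕ.^_) m≡2k) (proj₂ (4^k≡1+3i k)))))
      where
      i = proj₁ (4^k≡1+3i k)
      rearrange : ∀ i → suc i ℕ.* 3 ≡ suc (suc (1 ℕ.+ 3 ℕ.* i))
      rearrange = N.solve 1 (λ i → (N.con 1 N.:+ i) N.:* N.con 3 N.:= N.con 3 N.:+ N.con 3 N.:* i) ≡.refl
        where module N = +-*-Solver

    module Odd k (m≡1+2k : m ≡ suc (k ℕ.* 2)) where

      -- The exponent with 3j = 2q - 1: for q = 2(1 + 3i) this is 1 + 4i. Raising to the power j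
      -- inverts cubing on the non-zero elements of the subfield.
      j : ℕ
      j = 1 ℕ.+ 4 ℕ.* proj₁ (4^k≡1+3i k)

      1+j*3≡2q : suc (j ℕ.* 3) ≡ q ℕ.* 2
      1+j*3≡2q = ≡.trans (solveℕ (proj₁ (4^k≡1+3i k))) (≡.cong (ℕ._* 2)
        (≡.sym (≡.trans (≡.cong (2 ℕ.^_) m≡1+2k) (≡.cong (2 ℕ.*_) (proj₂ (4^k≡1+3i k))))))
        where
        module N = +-*-Solver
        solveℕ : ∀ i → suc ((1 ℕ.+ 4 ℕ.* i) ℕ.* 3) ≡ (2 ℕ.* (1 ℕ.+ 3 ℕ.* i)) ℕ.* 2
        solveℕ = N.solve 1 (λ i → N.con 1 N.:+ (N.con 1 N.:+ N.con 4 N.:* i) N.:* N.con 3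
                      N.:= (N.con 2 N.:* (N.con 1 N.:+ N.con 3 N.:* i)) N.:* N.con 2) ≡.refl

      u^j^3≈u : ∀ {u} → u ≉ 0# → u ∈ 𝔽 q → (u ^ j) ^ 3 ≈ u
      u^j^3≈u u≉0 u∈𝔽 = trans (^-assocʳ _ j 3) (u^[2q-1]≈u 1+j*3≡2q u≉0 u∈𝔽)

      cube-injective : ∀ {u v} → u ≉ 0# → v ≉ 0# → u ∈ 𝔽 q → v ∈ 𝔽 q → u ^ 3 ≈ v ^ 3 → u ≈ v
      cube-injective {u} {v} u≉0 v≉0 u∈𝔽 v∈𝔽 u³≈v³ = begin
        u              ≈⟨ u^j^3≈u u≉0 u∈𝔽 ⟨
        (u ^ j) ^ 3    ≈⟨ ^-comm u j 3 ⟩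
        (u ^ 3) ^ j    ≈⟨ ^-congˡ j u³≈v³ ⟩
        (v ^ 3) ^ j    ≈⟨ ^-comm v 3 j ⟩
        (v ^ j) ^ 3    ≈⟨ u^j^3≈u v≉0 v∈𝔽 ⟩
        v              ∎

      reducible-trace-0 : Tr m d ≈ 0# → ∃[ x ] (x ∈ 𝔽 q × cubic α β x ≈ 0#)
      reducible-trace-0 Tr≈0 =
        let u , root = root-exists a∉𝔽 d∈𝔽
            u∈𝔽 = fixed-root Tr≈0 root
        in cubic-root-𝔽 (𝔽-^ j u∈𝔽) (trans (resolvent-cong refl refl (u^j^3≈u (resolvent-root≉0 root) u∈𝔽)) root)

      -- The norm of y and α lie in the subfield and have equal cubes, because y³ has norm α³;
      -- cubing is injective there, so y has norm α.
      reducible-cube : ∀ {y} → Tr m d ≈ 1# → resolvent α β (y ^ 3) ≈ 0# → ∃[ x ] (x ∈ 𝔽 q × cubic α β x ≈ 0#)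
      reducible-cube {y} Tr≈1 root = cubic-root-norm
        (cube-injective (*-≉0 y≉0 (^-≉0 y≉0 q)) α≉0 (x*xᑫ∈𝔽 y) α∈𝔽 (begin
          (y * y ^ q) ^ 3             ≈⟨ ^-distrib-* y (y ^ q) 3 ⟩
          y ^ 3 * (y ^ q) ^ 3         ≈⟨ *-congˡ (^-comm y q 3) ⟩
          y ^ 3 * (y ^ 3) ^ q         ≈⟨ norm-root Tr≈1 root ⟩
          α ^ 3                       ∎))
        root
        where
        y≉0 : y ≉ 0#
        y≉0 = resolvent-root≉0 root ∘ λ y≈0 → trans (^-congˡ 3 y≈0) (zeroˡ _)

    module _ {x} (x∈𝔽 : x ∈ 𝔽 q) (x-root : cubic α β x ≈ 0#) where

      x≉0 : x ≉ 0#
      x≉0 x≈0 = β≉0 (begin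
        β               ≈⟨ solve 2 (λ α β → β := con false :^ 3 :+ α :* con false :+ β) refl α β ⟩
        cubic α β 0#    ≈⟨ cubic-cong refl refl x≈0 ⟨
        cubic α β x     ≈⟨ x-root ⟩
        0#              ∎)

      -- The Artin-Schreier constant α/x² of y² + x y + α, whose trace decides whether the Cardano
      -- cube roots y and y + x lie in the subfield.
      e : Carrier
      e = α * (x ⁻¹) ^ 2

      ex²≈α : e * x ^ 2 ≈ α
      ex²≈α = begin
        α * (x ⁻¹) ^ 2 * x ^ 2      ≈⟨ solve 3 (λ α x i → α :* i :^ 2 :* x :^ 2 := α :* (x :* i) :^ 2) refl α x (x ⁻¹) ⟩
        α * (x * x ⁻¹) ^ 2          ≈⟨ *-congˡ (^-congˡ 2 (*-inverseʳ x x≉0)) ⟩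
        α * 1# ^ 2                  ≈⟨ trans (*-congˡ (1^≈1 2)) (*-identityʳ α) ⟩
        α                           ∎

      e∈𝔽 : e ∈ 𝔽 q
      e∈𝔽 = 𝔽-* α∈𝔽 (𝔽-^ 2 (𝔽-⁻¹ x≉0 x∈𝔽))

      -- Cardano backwards: y is taken with y + α/y = x, that is, as a root of y² + x y + α, which
      -- exists in K because e lies in the subfield.
      cube-resolvent-root : ∃[ y ] (resolvent α β (y ^ 3) ≈ 0# × (Tr m d ≈ 0# → y ∈ 𝔽 q))
      cube-resolvent-root = y , root , y∈𝔽
        where
        open QuadraticRoots x∈𝔽 x≉0 ex²≈α renaming (root-exists to y-exists; root-conj to y-conj) using ()
        y : Carrier
        y = proj₁ (y-exists a∉𝔽 e∈𝔽)
        y-root : y ^ 2 + x * y + α ≈ 0#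
        y-root = proj₂ (y-exists a∉𝔽 e∈𝔽)
        yy′≈α : y * (y + x) ≈ α
        yy′≈α = trans (solve 2 (λ y x → y :* (y :+ x) := y :^ 2 :+ x :* y) refl y x) (+≈0⇒≈ y-root)
        root : resolvent α β (y ^ 3) ≈ 0#
        root = begin
          resolvent α β (y ^ 3)                  ≈⟨ resolvent-cubic β yy′≈α ⟩
          y ^ 3 * cubic α β (y + (y + x))        ≈⟨ *-congˡ (trans (cubic-cong refl refl (solve 2 (λ y x → y :+ (y :+ x) := x) refl y x)) x-root) ⟩
          y ^ 3 * 0#                             ≈⟨ zeroʳ (y ^ 3) ⟩
          0#                                     ∎
        -- If y ∉ 𝔽 q, then its conjugate is y + x = α / y, so the fixed element y³ satisfies
        -- y⁶ = α³, which the resolvent forbids.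
        y∈𝔽 : Tr m d ≈ 0# → y ∈ 𝔽 q
        y∈𝔽 Tr≈0 with Tr≈0⊎Tr≈1 e∈𝔽
        ... | inj₁ Tr-e≈0 = trans (y-conj y-root)
                              (trans (+-congˡ (trans (*-congˡ Tr-e≈0) (zeroʳ x))) (+-identityʳ y))
        ... | inj₂ Tr-e≈1 = contradiction βy³≈0 (*-≉0 β≉0 (resolvent-root≉0 root))
          where
          yᑫ≈y+x : y ^ q ≈ y + x
          yᑫ≈y+x = trans (y-conj y-root)
                     (+-congˡ (trans (*-congˡ Tr-e≈1) (*-identityʳ x)))
          α³≈y³² : α ^ 3 ≈ (y ^ 3) ^ 2
          α³≈y³² = begin
            α ^ 3                    ≈⟨ ^-congˡ 3 (trans (sym yy′≈α) (*-congˡ (sym yᑫ≈y+x))) ⟩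
            (y * y ^ q) ^ 3          ≈⟨ ^-distrib-* y (y ^ q) 3 ⟩
            y ^ 3 * (y ^ q) ^ 3      ≈⟨ *-congˡ (trans (^-comm y q 3) (fixed-root Tr≈0 root)) ⟩
            y ^ 3 * y ^ 3            ≈⟨ *-congˡ (*-identityʳ (y ^ 3)) ⟨
            (y ^ 3) ^ 2              ∎
          βy³≈0 : β * y ^ 3 ≈ 0#
          βy³≈0 = begin
            β * y ^ 3                                  ≈⟨ solve 2 (λ u v → v := u :+ v :+ u) refl ((y ^ 3) ^ 2) (β * y ^ 3) ⟩
            (y ^ 3) ^ 2 + β * y ^ 3 + (y ^ 3) ^ 2      ≈⟨ +-congˡ α³≈y³² ⟨
            resolvent α β (y ^ 3)                      ≈⟨ root ⟩
            0#                                         ∎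

    -- A root x produces a resolvent root that is a cube in the field relevant to the parity of m.
    -- Conversely, a wrong trace or such a cube produces a root x.
    criterion : (∀ x → x ∈ 𝔽 q → cubic α β x ≉ 0#) ⇔
                (Tr m d ≈ Tr m 1# × (∀ u → resolvent α β u ≈ 0# → NonCube u))
    criterion = mk⇔ irreducible⇒ ⇒irreducible
      where
      odd⇒2∤ : ∀ k → m ≡ suc (k ℕ.* 2) → 2 ∤ m
      odd⇒2∤ k m≡1+2k (divides j m≡2j) = ℕ.even≢odd j k (≡.trans (≡.trans (ℕ.*-comm 2 j) (≡.trans (≡.sym m≡2j) m≡1+2k)) (≡.cong suc (ℕ.*-comm k 2)))

      Tr-1≈0 : ∀ k → m ≡ k ℕ.* 2 → Tr m 1# ≈ 0#
      Tr-1≈0 k m≡2k = ≡.subst (λ n → Tr n 1# ≈ 0#) (≡.sym m≡2k) (Tr-1-even k)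

      Tr-1≈1 : ∀ k → m ≡ suc (k ℕ.* 2) → Tr m 1# ≈ 1#
      Tr-1≈1 k m≡1+2k = ≡.subst (λ n → Tr n 1# ≈ 1#) (≡.sym m≡1+2k) (Tr-1-odd k)

      ⇒irreducible : (Tr m d ≈ Tr m 1# × (∀ u → resolvent α β u ≈ 0# → NonCube u)) → ∀ x → x ∈ 𝔽 q → cubic α β x ≉ 0#
      ⇒irreducible (Tr≈ , noncube) x x∈𝔽 x-root with even⊎odd m
      -- For even m a cube root in 𝔽 q is needed, and Tr d = Tr 1 = 0 puts `y` there; for odd m any
      -- `y` in K suffices.
      ... | inj₁ (k , m≡2k)   =
        let y , root , y∈𝔽 = cube-resolvent-root x∈𝔽 x-root
        in proj₁ (noncube _ root) (divides k m≡2k) (y , y∈𝔽 (trans Tr≈ (Tr-1≈0 k m≡2k)) , refl)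
      ... | inj₂ (k , m≡1+2k) =
        let y , root , _ = cube-resolvent-root x∈𝔽 x-root
        in proj₂ (noncube _ root) (odd⇒2∤ k m≡1+2k) (y , _ , refl)

      irreducible⇒ : (∀ x → x ∈ 𝔽 q → cubic α β x ≉ 0#) → Tr m d ≈ Tr m 1# × (∀ u → resolvent α β u ≈ 0# → NonCube u)
      irreducible⇒ no-root = Tr≈ , λ u root → even u root , odd u root
        where
        reducible : ∀ {a} {A : Set a} → ∃[ x ] (x ∈ 𝔽 q × cubic α β x ≈ 0#) → A
        reducible (x , x∈𝔽 , x-root) = contradiction x-root (no-root x x∈𝔽)

        Tr≈ : Tr m d ≈ Tr m 1#
        -- When Tr d differs from the parity of m, every root of the resolvent has a suitable cube
        -- root, and one root exists in K.
        Tr≈ with even⊎odd m | Tr≈0⊎Tr≈1 d∈𝔽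
        ... | inj₁ (k , m≡2k)   | inj₁ Tr≈0 = trans Tr≈0 (sym (Tr-1≈0 k m≡2k))
        ... | inj₁ (k , m≡2k)   | inj₂ Tr≈1 = reducible (reducible-trace-1 (proj₁ (3∣q+2 k m≡2k)) (proj₂ (3∣q+2 k m≡2k)) Tr≈1 (proj₂ (root-exists a∉𝔽 d∈𝔽)))
        ... | inj₂ (k , m≡1+2k) | inj₁ Tr≈0 = reducible (Odd.reducible-trace-0 k m≡1+2k Tr≈0)
        ... | inj₂ (k , m≡1+2k) | inj₂ Tr≈1 = trans Tr≈1 (sym (Tr-1≈1 k m≡1+2k))

        even : ∀ u → resolvent α β u ≈ 0# → 2 ∣ m → ¬ IsCubeIn (𝔽 q) u
        even u root _ (y , y∈𝔽 , y³≈u) = reducible (cubic-root-𝔽 y∈𝔽 (trans (resolvent-cong refl refl y³≈u) root))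

        odd : ∀ u → resolvent α β u ≈ 0# → 2 ∤ m → ¬ IsCubeIn U u
        odd u root 2∤m (y , _ , y³≈u) with even⊎odd m
        ... | inj₁ (k , m≡2k)   = 2∤m (divides k m≡2k)
        ... | inj₂ (k , m≡1+2k) = reducible
          (Odd.reducible-cube k m≡1+2k (trans Tr≈ (Tr-1≈1 k m≡1+2k)) (trans (resolvent-cong refl refl y³≈u) root))

  -- The cubic on the roots of unity

  module CubicOnμ (a b : Carrier) (a∉𝔽 : a ∉ 𝔽 q) (b∈𝔽 : b ∈ 𝔽 q) where

    A : Carrier → Carrier
    A z = a ^ q + b * z + b * z ^ 2 + a * z ^ 3

    A-cong : ∀ {z w} → z ≈ w → A z ≈ A w
    A-cong z≈w = +-cong (+-cong (+-congˡ (*-congˡ z≈w)) (*-congˡ (^-congˡ 2 z≈w))) (*-congˡ (^-congˡ 3 z≈w))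

    -- The cubic has α = `M`, the norm of a + b, and β = `T * N`, where `T` is the relative trace of
    -- a.
    T M N : Carrier
    T = a + a ^ q
    M = (a ^ q + b) * (a + b)
    N = a ^ suc q + b ^ 2

    T≉0 : T ≉ 0#
    T≉0 = ∉𝔽⇒x+xᑫ≉0 a∉𝔽

    M∈𝔽 : M ∈ 𝔽 q
    M∈𝔽 = 𝔽-cong (trans (*-congˡ conj-[a+b]) (*-comm _ _)) (x*xᑫ∈𝔽 (a + b))
      where
      conj-[a+b] : (a + b) ^ q ≈ a ^ q + b
      conj-[a+b] = trans (conj-+ a b) (+-congˡ b∈𝔽)

    N∈𝔽 : N ∈ 𝔽 q
    N∈𝔽 = 𝔽-+ (x*xᑫ∈𝔽 a) (𝔽-^ 2 b∈𝔽)

    M≉0 : M ≉ 0#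
    M≉0 = *-≉0 (λ aᑫ+b≈0 → a∉𝔽 (begin
        a ^ q              ≈⟨ +≈0⇒≈ aᑫ+b≈0 ⟩
        b                  ≈⟨ b∈𝔽 ⟨
        b ^ q              ≈⟨ ^-congˡ q (+≈0⇒≈ aᑫ+b≈0) ⟨
        (a ^ q) ^ q        ≈⟨ conj-involutive a ⟩
        a                  ∎))
      (λ a+b≈0 → a∉𝔽 (𝔽-cong (sym (+≈0⇒≈ a+b≈0)) b∈𝔽))

    TN∈𝔽 : T * N ∈ 𝔽 q
    TN∈𝔽 = 𝔽-* (x+xᑫ∈𝔽 a) N∈𝔽

    -- The substitution enters as z p = w and denominators are cleared by p³. Homogenised in p and
    -- w, A becomes T times the depressed cubic, an identity over 𝔽₂.
    A-cubic : ∀ x z → z * (x + b + a) ≈ x + b + a ^ q → (x + b + a) ^ 3 * A z ≈ T * cubic M (T * N) x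
    A-cubic x z zp≈w = begin
      p ^ 3 * A z
        ≈⟨ solve 5 (λ p z a a′ b → p :^ 3 :* (a′ :+ b :* z :+ b :* z :^ 2 :+ a :* z :^ 3)
             := a′ :* p :^ 3 :+ b :* p :^ 2 :* (z :* p) :+ b :* p :* (z :* p) :^ 2 :+ a :* (z :* p) :^ 3) refl p z a (a ^ q) b ⟩
      a ^ q * p ^ 3 + b * p ^ 2 * (z * p) + b * p * (z * p) ^ 2 + a * (z * p) ^ 3
        ≈⟨ +-cong (+-cong (+-congˡ (*-congˡ zp≈w)) (*-congˡ (^-congˡ 2 zp≈w))) (*-congˡ (^-congˡ 3 zp≈w)) ⟩
      a ^ q * p ^ 3 + b * p ^ 2 * w + b * p * w ^ 2 + a * w ^ 3
        ≈⟨ solve 4 (λ x a a′ b →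
             let p = x :+ b :+ a ; w = x :+ b :+ a′ ; T = a :+ a′ in
             a′ :* p :^ 3 :+ b :* p :^ 2 :* w :+ b :* p :* w :^ 2 :+ a :* w :^ 3
             := T :* (x :^ 3 :+ ((a′ :+ b) :* (a :+ b)) :* x :+ T :* (a :* a′ :+ b :^ 2))) refl x a (a ^ q) b ⟩
      T * cubic M (T * N) x  ∎
      where
      p = x + b + a
      w = x + b + a ^ q

    -- Solving z (x + b + a) = x + b + a^q for x gives b + (a z + a^q)/(z + 1). Conjugation divides
    -- numerator and denominator both by z, so the quotient is fixed.
    μ-root⇒𝔽-root : ∀ {z} → z ∈ μ (suc q) → A z ≈ 0# → ∃[ x ] (x ∈ 𝔽 q × cubic M (T * N) x ≈ 0#)
    μ-root⇒𝔽-root {z} z∈μ Az≈0 = x , x∈𝔽 , *-cancelˡ-≈0 T≉0 (trans (sym (A-cubic x z zp≈w)) (trans (*-congˡ Az≈0) (zeroʳ _)))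
      where
      k v x : Carrier
      k = z + 1#
      v = a * z + a ^ q
      x = b + k ⁻¹ * v
      k≉0 : k ≉ 0#
      -- The pole z = 1 is no root, since the two b terms cancel and A(1) = T.
      k≉0 k≈0 = T≉0 (begin
        T            ≈⟨ solve 3 (λ a a′ b → a :+ a′ := a′ :+ b :* con true :+ b :* con true :^ 2 :+ a :* con true :^ 3) refl a (a ^ q) b ⟩
        A 1#         ≈⟨ A-cong (+≈0⇒≈ k≈0) ⟨
        A z          ≈⟨ Az≈0 ⟩
        0#           ∎)
      kκ : k * (k ⁻¹ * v) ≈ v
      kκ = x*[x⁻¹*y] k≉0 v
      kᑫz≈k : k ^ q * z ≈ k
      kᑫz≈k = begin
        (z + 1#) ^ q * z          ≈⟨ *-congʳ (trans (conj-+ z 1#) (+-congˡ (1^≈1 q))) ⟩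
        (z ^ q + 1#) * z          ≈⟨ solve 2 (λ y z → (y :+ con true) :* z := z :* y :+ z) refl (z ^ q) z ⟩
        z * z ^ q + z             ≈⟨ +-congʳ z∈μ ⟩
        1# + z                    ≈⟨ +-comm 1# z ⟩
        k                         ∎
      vᑫz≈v : v ^ q * z ≈ v
      vᑫz≈v = begin
        (a * z + a ^ q) ^ q * z             ≈⟨ *-congʳ (trans (conj-+ (a * z) (a ^ q)) (+-cong (conj-* a z) (conj-involutive a))) ⟩
        (a ^ q * z ^ q + a) * z             ≈⟨ solve 4 (λ a a′ y z → (a′ :* y :+ a) :* z := a :* z :+ a′ :* (z :* y)) refl a (a ^ q) (z ^ q) z ⟩
        a * z + a ^ q * (z * z ^ q)         ≈⟨ +-congˡ (trans (*-congˡ z∈μ) (*-identityʳ _)) ⟩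
        v                                   ∎
      x∈𝔽 : x ∈ 𝔽 q
      x∈𝔽 = 𝔽-+ b∈𝔽 (*-cancelˡ-≉0 k≉0 (begin
        k * (k ⁻¹ * v) ^ q                       ≈⟨ *-congʳ kᑫz≈k ⟨
        k ^ q * z * (k ⁻¹ * v) ^ q               ≈⟨ solve 3 (λ K z V → K :* z :* V := K :* V :* z) refl (k ^ q) z ((k ⁻¹ * v) ^ q) ⟩
        k ^ q * (k ⁻¹ * v) ^ q * z               ≈⟨ *-congʳ (trans (sym (conj-* k (k ⁻¹ * v))) (^-congˡ q kκ)) ⟩
        v ^ q * z                                ≈⟨ vᑫz≈v ⟩
        v                                        ≈⟨ kκ ⟨
        k * (k ⁻¹ * v)                           ∎))
      zp≈w : z * (x + b + a) ≈ x + b + a ^ q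
      zp≈w = *-cancelˡ-≉0 k≉0 (begin
        k * (z * (x + b + a))          ≈⟨ solve 5 (λ k z b κ a → k :* (z :* (b :+ κ :+ b :+ a)) := z :* (k :* κ :+ k :* a)) refl k z b (k ⁻¹ * v) a ⟩
        z * (k * (k ⁻¹ * v) + k * a)   ≈⟨ *-congˡ (+-congʳ kκ) ⟩
        z * (v + k * a)                ≈⟨ solve 3 (λ z a a′ → z :* ((a :* z :+ a′) :+ (z :+ con true) :* a) := (a :* z :+ a′) :+ (z :+ con true) :* a′) refl z a (a ^ q) ⟩
        v + k * a ^ q                  ≈⟨ +-congʳ kκ ⟨
        k * (k ⁻¹ * v) + k * a ^ q     ≈⟨ solve 4 (λ k b κ a′ → k :* κ :+ k :* a′ := k :* (b :+ κ :+ b :+ a′)) refl k b (k ⁻¹ * v) (a ^ q) ⟩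
        k * (x + b + a ^ q)            ∎)

    -- For x in the subfield w is the conjugate of p, so z = w / p has norm 1; p = 0 would put a
    -- into the subfield.
    𝔽-root⇒μ-root : ∀ {x} → x ∈ 𝔽 q → cubic M (T * N) x ≈ 0# → ∃[ z ] (z ∈ μ (suc q) × A z ≈ 0#)
    𝔽-root⇒μ-root {x} x∈𝔽 x-root = z , z∈μ , *-cancelˡ-≈0 (^-≉0 p≉0 3) (trans (A-cubic x z zp≈w) (trans (*-congˡ x-root) (zeroʳ T)))
      where
      p w z : Carrier
      p = x + b + a
      w = x + b + a ^ q
      z = p ⁻¹ * w
      p≉0 : p ≉ 0#
      p≉0 p≈0 = a∉𝔽 (𝔽-cong (+≈0⇒≈ p≈0) (𝔽-+ x∈𝔽 b∈𝔽))
      zp≈w : z * p ≈ w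
      zp≈w = trans (*-comm z p) (x*[x⁻¹*y] p≉0 w)
      pᑫ≈w : p ^ q ≈ w
      pᑫ≈w = trans (conj-+ (x + b) a) (+-congʳ (𝔽-+ x∈𝔽 b∈𝔽))
      wᑫ≈p : w ^ q ≈ p
      wᑫ≈p = trans (^-congˡ q (sym pᑫ≈w)) (conj-involutive p)
      z∈μ : z ∈ μ (suc q)
      z∈μ = *-cancelˡ-≉0 p≉0 (begin
        p * (z * z ^ q)           ≈⟨ solve 3 (λ p z y → p :* (z :* y) := y :* (z :* p)) refl p z (z ^ q) ⟩
        z ^ q * (z * p)           ≈⟨ *-congˡ (trans zp≈w (sym pᑫ≈w)) ⟩
        z ^ q * p ^ q             ≈⟨ trans (sym (conj-* z p)) (^-congˡ q zp≈w) ⟩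
        w ^ q                     ≈⟨ wᑫ≈p ⟩
        p                         ≈⟨ *-identityʳ p ⟨
        p * 1#                    ∎)

    A-conj : ∀ {z} → z ∈ μ (suc q) → A z ^ q * z ^ 3 ≈ A z
    A-conj {z} z∈μ = begin
      A z ^ q * z ^ 3
        ≈⟨ *-congʳ (trans (conj-+ _ _) (+-cong (trans (conj-+ _ _) (+-cong (trans (conj-+ _ _)
             (+-cong (conj-involutive a) (trans (conj-* b z) (*-congʳ b∈𝔽))))
             (trans (conj-* b (z ^ 2)) (*-cong b∈𝔽 (^-comm z 2 q)))))
             (trans (conj-* a (z ^ 3)) (*-congˡ (^-comm z 3 q))))) ⟩
      (a + b * y + b * y ^ 2 + a ^ q * y ^ 3) * z ^ 3
        ≈⟨ solve 5 (λ a a′ b y z → (a :+ b :* y :+ b :* y :^ 2 :+ a′ :* y :^ 3) :* z :^ 3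
             := a :* z :^ 3 :+ b :* (z :* y) :* z :^ 2 :+ b :* (z :* y) :^ 2 :* z :+ a′ :* (z :* y) :^ 3) refl a (a ^ q) b y z ⟩
      a * z ^ 3 + b * (z * y) * z ^ 2 + b * (z * y) ^ 2 * z + a ^ q * (z * y) ^ 3
        ≈⟨ +-cong (+-cong (+-congˡ (*-congʳ (*-congˡ z∈μ))) (*-congʳ (*-congˡ (^-congˡ 2 z∈μ)))) (*-congˡ (^-congˡ 3 z∈μ)) ⟩
      a * z ^ 3 + b * 1# * z ^ 2 + b * 1# ^ 2 * z + a ^ q * 1# ^ 3
        ≈⟨ solve 4 (λ a a′ b z → a :* z :^ 3 :+ b :* con true :* z :^ 2 :+ b :* con true :^ 2 :* z :+ a′ :* con true :^ 3
             := a′ :+ b :* z :+ b :* z :^ 2 :+ a :* z :^ 3) refl a (a ^ q) b z ⟩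
      A z ∎
      where y = z ^ q

    -- The trace and cube conditions in terms of the resolvent.

    TraceCondition ResolventCondition : Set _
    TraceCondition = Tr m (((a ^ q + b) ^ 3 * (a + b) ^ 3) / (T ^ 2 * N ^ 2)) ≈ Tr m 1#
    ResolventCondition = ∀ δ → δ ∉ 𝔽 q → ∀ t →
        t ^ 2
        + (((δ ^ q + δ) ^ 3 * N) / T ^ 2) * t
        + ((δ + δ ^ q) ^ 6 * (a ^ q + b) ^ 3 * (a + b) ^ 3) / T ^ 6
        ≈ 0# → NonCube t

    x/y*y≈x : ∀ {y} x → y ≉ 0# → x / y * y ≈ x
    x/y*y≈x x y≉0 = trans (*-assoc x _ _) (trans (*-congˡ (*-inverseˡ y≉0)) (*-identityʳ x))

    -- The quadratic in δ is the resolvent up to scaling its roots by a cube of the subfield, so one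
    -- δ carries as much information as all of them.
    no-root⇔ : N ≉ 0# → (∀ z → z ∈ μ (suc q) → A z ≉ 0#) ⇔ (TraceCondition × ResolventCondition)
    no-root⇔ N≉0 = mk⇔
      (λ no-root →
        let trace , noncube = Equivalence.to criterion λ x x∈𝔽 x-root →
              let z , z∈μ , Az≈0 = 𝔽-root⇒μ-root x∈𝔽 x-root in no-root z z∈μ Az≈0
        in trace , λ δ δ∉𝔽 t t-root → rescale δ δ∉𝔽 t t-root noncube)
      (λ (trace , noncube) z z∈μ Az≈0 →
        let x , x∈𝔽 , x-root = μ-root⇒𝔽-root z∈μ Az≈0
        -- Choosing δ = a cancels the denominators and leaves the coefficients T N and M³ of the
        -- resolvent itself.
        in Equivalence.from criterion (trace , λ u u-root → noncube a a∉𝔽 u (trans (sym (scale-a u)) u-root)) x x∈𝔽 x-root)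
      where
      dβ²≈α³ : (((a ^ q + b) ^ 3 * (a + b) ^ 3) / (T ^ 2 * N ^ 2)) * (T * N) ^ 2 ≈ M ^ 3
      dβ²≈α³ = begin
        (((a ^ q + b) ^ 3 * (a + b) ^ 3) / (T ^ 2 * N ^ 2)) * (T * N) ^ 2        ≈⟨ *-congˡ (^-distrib-* T N 2) ⟩
        (((a ^ q + b) ^ 3 * (a + b) ^ 3) / (T ^ 2 * N ^ 2)) * (T ^ 2 * N ^ 2)    ≈⟨ x/y*y≈x _ (*-≉0 (^-≉0 T≉0 2) (^-≉0 N≉0 2)) ⟩
        (a ^ q + b) ^ 3 * (a + b) ^ 3                                            ≈⟨ ^-distrib-* (a ^ q + b) (a + b) 3 ⟨
        M ^ 3                                                                    ∎
      open CubicCriterion a∉𝔽 M∈𝔽 TN∈𝔽 M≉0 (*-≉0 T≉0 N≉0) dβ²≈α³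

      [T^k*x]/T^k : ∀ k {x y} → y ≈ T ^ k * x → y / T ^ k ≈ x
      [T^k*x]/T^k k y≈ = trans (*-comm _ _) (trans (*-congˡ y≈) (x⁻¹*[x*y] (^-≉0 T≉0 k) _))

      scale-a : ∀ u → resolvent M (T * N) u ≈ u ^ 2 + (((a ^ q + a) ^ 3 * N) / T ^ 2) * u
                                               + ((a + a ^ q) ^ 6 * (a ^ q + b) ^ 3 * (a + b) ^ 3) / T ^ 6
      scale-a u = +-cong (+-congˡ (*-congʳ (sym ([T^k*x]/T^k 2
          (solve 3 (λ a a′ N → (a′ :+ a) :^ 3 :* N := (a :+ a′) :^ 2 :* ((a :+ a′) :* N)) refl a (a ^ q) N)))))
        (sym ([T^k*x]/T^k 6 (trans (*-assoc _ _ _) (*-congˡ (sym (^-distrib-* (a ^ q + b) (a + b) 3))))))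

      -- The roots for δ are the roots for a times the cube of (δ + δ^q) / (a + a^q).
      rescale : ∀ δ → δ ∉ 𝔽 q → ∀ t → _ → (∀ u → resolvent M (T * N) u ≈ 0# → NonCube u) → NonCube t
      rescale δ δ∉𝔽 t t-root noncube =
        (λ 2∣m (y , y∈𝔽 , y³≈t) → proj₁ nc 2∣m (κ * y , 𝔽-* κ∈𝔽 y∈𝔽 , trans (^-distrib-* κ y 3) (*-congˡ y³≈t))) ,
        (λ 2∤m (y , _ , y³≈t) → proj₂ nc 2∤m (κ * y , _ , trans (^-distrib-* κ y 3) (*-congˡ y³≈t)))
        where
        D κ : Carrier
        D = δ + δ ^ q
        -- The inverse scaling factor, from δ back to a. It lies in 𝔽 q, so multiplying by its cube
        -- sends cubes to cubes in either field.
        κ = D ⁻¹ * T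
        D≉0 : D ≉ 0#
        D≉0 = ∉𝔽⇒x+xᑫ≉0 δ∉𝔽
        κ∈𝔽 : κ ∈ 𝔽 q
        κ∈𝔽 = 𝔽-* (𝔽-⁻¹ D≉0 (x+xᑫ∈𝔽 δ)) (x+xᑫ∈𝔽 a)
        Dκ≈T : D * κ ≈ T
        Dκ≈T = x*[x⁻¹*y] D≉0 T
        P Q : Carrier
        P = ((δ ^ q + δ) ^ 3 * N) / T ^ 2
        Q = (D ^ 6 * (a ^ q + b) ^ 3 * (a + b) ^ 3) / T ^ 6
        TN≈κ³P : T * N ≈ κ ^ 3 * P
        TN≈κ³P = *-cancelˡ-≉0 (^-≉0 T≉0 2) (begin
          T ^ 2 * (T * N)                         ≈⟨ solve 2 (λ T N → T :^ 2 :* (T :* N) := T :^ 3 :* N) refl T N ⟩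
          T ^ 3 * N                               ≈⟨ *-congʳ (^-congˡ 3 Dκ≈T) ⟨
          (D * κ) ^ 3 * N                         ≈⟨ solve 4 (λ d d′ κ N → ((d :+ d′) :* κ) :^ 3 :* N := κ :^ 3 :* ((d′ :+ d) :^ 3 :* N)) refl δ (δ ^ q) κ N ⟩
          κ ^ 3 * ((δ ^ q + δ) ^ 3 * N)           ≈⟨ *-congˡ (x/y*y≈x _ (^-≉0 T≉0 2)) ⟨
          κ ^ 3 * (P * T ^ 2)                     ≈⟨ solve 3 (λ k P t → k :* (P :* t) := t :* (k :* P)) refl (κ ^ 3) P (T ^ 2) ⟩
          T ^ 2 * (κ ^ 3 * P)                     ∎)
        M³≈κ⁶Q : M ^ 3 ≈ κ ^ 6 * Q
        M³≈κ⁶Q = *-cancelˡ-≉0 (^-≉0 T≉0 6) (begin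
          T ^ 6 * M ^ 3                                             ≈⟨ *-cong (^-congˡ 6 Dκ≈T) (sym (^-distrib-* (a ^ q + b) (a + b) 3)) ⟨
          (D * κ) ^ 6 * ((a ^ q + b) ^ 3 * (a + b) ^ 3)             ≈⟨ *-congʳ (^-distrib-* D κ 6) ⟩
          D ^ 6 * κ ^ 6 * ((a ^ q + b) ^ 3 * (a + b) ^ 3)           ≈⟨ solve 4 (λ d k u v → d :* k :* (u :* v) := k :* (d :* u :* v)) refl (D ^ 6) (κ ^ 6) _ _ ⟩
          κ ^ 6 * (D ^ 6 * (a ^ q + b) ^ 3 * (a + b) ^ 3)           ≈⟨ *-congˡ (x/y*y≈x _ (^-≉0 T≉0 6)) ⟨
          κ ^ 6 * (Q * T ^ 6)                                       ≈⟨ solve 3 (λ k P t → k :* (P :* t) := t :* (k :* P)) refl (κ ^ 6) Q (T ^ 6) ⟩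
          T ^ 6 * (κ ^ 6 * Q)                                       ∎)
        nc : NonCube (κ ^ 3 * t)
        nc = noncube (κ ^ 3 * t) (begin
          (κ ^ 3 * t) ^ 2 + T * N * (κ ^ 3 * t) + M ^ 3                        ≈⟨ +-cong (+-congˡ (*-congʳ TN≈κ³P)) M³≈κ⁶Q ⟩
          (κ ^ 3 * t) ^ 2 + κ ^ 3 * P * (κ ^ 3 * t) + κ ^ 6 * Q                ≈⟨ solve 4 (λ κ t P Q → (κ :^ 3 :* t) :^ 2 :+ κ :^ 3 :* P :* (κ :^ 3 :* t) :+ κ :^ 6 :* Q
                                                                                     := κ :^ 6 :* (t :^ 2 :+ P :* t :+ Q)) refl κ t P Q ⟩
          κ ^ 6 * (t ^ 2 + P * t + Q)                                          ≈⟨ *-congˡ t-root ⟩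
          κ ^ 6 * 0#                                                           ≈⟨ zeroʳ _ ⟩
          0#                                                                   ∎)

  -- Permutations of the form x^s C(x^(q-1))

  1+[q-1]≡q : suc (q ∸ 1) ≡ q
  1+[q-1]≡q = ℕ.m+[n∸m]≡n q>0

  x^[q-1]*x≈xᑫ : ∀ x → x ^ (q ∸ 1) * x ≈ x ^ q
  x^[q-1]*x≈xᑫ x = trans (*-comm _ x) (^-congʳ x 1+[q-1]≡q)

  x^[q-1]∈μ : ∀ {x} → x ≉ 0# → x ^ (q ∸ 1) ∈ μ (suc q)
  x^[q-1]∈μ {x} x≉0 = *-cancelˡ-≉0 x≉0 (begin
    x * (z * z ^ q)       ≈⟨ solve 3 (λ x z y → x :* (z :* y) := y :* (z :* x)) refl x z (z ^ q) ⟩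
    z ^ q * (z * x)       ≈⟨ *-congˡ (x^[q-1]*x≈xᑫ x) ⟩
    z ^ q * x ^ q         ≈⟨ conj-* z x ⟨
    (z * x) ^ q           ≈⟨ ^-congˡ q (x^[q-1]*x≈xᑫ x) ⟩
    (x ^ q) ^ q           ≈⟨ conj-involutive x ⟩
    x                     ≈⟨ *-identityʳ x ⟨
    x * 1#                ∎)
    where z = x ^ (q ∸ 1)

  -- Hilbert 90 with an explicit witness: x = 1 + z^q satisfies x^q = 1 + z = x z, and it vanishes
  -- only for z = 1, where x = 1 serves instead.
  ∈μ⇒[q-1]-power : ∀ {z} → z ∈ μ (suc q) → ∃[ x ] (x ≉ 0# × x ^ (q ∸ 1) ≈ z)
  ∈μ⇒[q-1]-power {z} z∈μ with z ≟ 1#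
  ... | yes z≈1 = 1# , 1≉0 , trans (1^≈1 (q ∸ 1)) (sym z≈1)
  ... | no  z≉1 = x , x≉0 , *-cancelˡ-≉0 x≉0 (begin
    x * x ^ (q ∸ 1)         ≈⟨ trans (*-comm x _) (x^[q-1]*x≈xᑫ x) ⟩
    (1# + z ^ q) ^ q        ≈⟨ trans (conj-+ 1# (z ^ q)) (+-cong (1^≈1 q) (conj-involutive z)) ⟩
    1# + z                  ≈⟨ +-congʳ z∈μ ⟨
    z * z ^ q + z           ≈⟨ solve 2 (λ z y → z :* y :+ z := (con true :+ y) :* z) refl z (z ^ q) ⟩
    x * z                   ∎)
    where
    x = 1# + z ^ q
    x≉0 : x ≉ 0#
    x≉0 x≈0 = z≉1 (begin
      z               ≈⟨ conj-involutive z ⟨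
      (z ^ q) ^ q     ≈⟨ ^-congˡ q (+≈0⇒≈ x≈0) ⟨
      1# ^ q          ≈⟨ 1^≈1 q ⟩
      1#              ∎)

  ^-gcd≈1 : ∀ {v} j k → v ^ j ≈ 1# → v ^ k ≈ 1# → v ^ gcd j k ≈ 1#
  ^-gcd≈1 {v} j k vʲ≈1 vᵏ≈1 = combine (Bézout.identity (gcd-GCD j k))
    where
    d = gcd j k
    multiple : ∀ {i} x → v ^ i ≈ 1# → v ^ (x ℕ.* i) ≈ 1#
    multiple {i} x vⁱ≈1 = trans (^-congʳ v (ℕ.*-comm x i)) (trans (sym (^-assocʳ v i x)) (trans (^-congˡ x vⁱ≈1) (1^≈1 x)))
    cancel : ∀ {i i′} → d ℕ.+ i ≡ i′ → v ^ i ≈ 1# → v ^ i′ ≈ 1# → v ^ d ≈ 1#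
    cancel {i} {i′} d+i≡i′ vⁱ≈1 vⁱ′≈1 = begin
      v ^ d             ≈⟨ *-identityʳ _ ⟨
      v ^ d * 1#        ≈⟨ *-congˡ vⁱ≈1 ⟨
      v ^ d * v ^ i     ≈⟨ ^-homo-* v d i ⟨
      v ^ (d ℕ.+ i)     ≈⟨ ^-congʳ v d+i≡i′ ⟩
      v ^ i′            ≈⟨ vⁱ′≈1 ⟩
      1#                ∎
    combine : Bézout.Identity d j k → v ^ d ≈ 1#
    combine (Bézout.+- x y eq) = cancel eq (multiple y vᵏ≈1) (multiple x vʲ≈1)
    combine (Bézout.-+ x y eq) = cancel eq (multiple x vʲ≈1) (multiple y vᵏ≈1)

  eval-conj : ∀ B z → eval B z ^ q ≈ eval (B ⁽ q ⁾) (z ^ q)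
  eval-conj []      z = 0^≈0 q>0
  eval-conj (b ∷ B) z = trans (conj-+ b _) (+-congˡ (trans (conj-* z _) (*-congˡ (eval-conj B z))))

  μ-^-% : ∀ {z} → z ∈ μ (suc q) → ∀ j → z ^ j ≈ z ^ (j % suc q)
  μ-^-% {z} z∈μ j = begin
    z ^ j                                                ≈⟨ ^-congʳ z (m≡m%n+[m/n]*n j (suc q)) ⟩
    z ^ (j % suc q ℕ.+ j ℕ./ suc q ℕ.* suc q)            ≈⟨ ^-homo-* z (j % suc q) _ ⟩
    z ^ (j % suc q) * z ^ (j ℕ./ suc q ℕ.* suc q)
      ≈⟨ *-congˡ (trans (^-congʳ z (ℕ.*-comm (j ℕ./ suc q) (suc q))) (trans (sym (^-assocʳ z (suc q) (j ℕ./ suc q))) (trans (^-congˡ (j ℕ./ suc q) z∈μ) (1^≈1 (j ℕ./ suc q))))) ⟩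
    z ^ (j % suc q) * 1#                                 ≈⟨ *-identityʳ _ ⟩
    z ^ (j % suc q)                                      ∎

  module ParkLee (s : ℕ) (s≥1 : s ≥ 1) (C : Carrier → Carrier) (C-cong : ∀ {z w} → z ≈ w → C z ≈ C w) where

    f : Carrier → Carrier
    f x = x ^ s * C (x ^ (q ∸ 1))

    f-cong : ∀ {x y} → x ≈ y → f x ≈ f y
    f-cong x≈y = *-cong (^-congˡ s x≈y) (C-cong (^-congˡ (q ∸ 1) x≈y))

    f0≈0 : ∀ {x} → x ≈ 0# → f x ≈ 0#
    f0≈0 x≈0 = trans (*-congʳ (trans (^-congˡ s x≈0) (0^≈0 s≥1))) (zeroˡ _)

    module _ (C≉0 : ∀ z → z ∈ μ (suc q) → C z ≉ 0#) where

      f≈0⇒≈0 : ∀ {x} → f x ≈ 0# → x ≈ 0#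
      f≈0⇒≈0 {x} fx≈0 with x ≟ 0#
      ... | yes x≈0 = x≈0
      ... | no  x≉0 = contradiction fx≈0 (*-≉0 (^-≉0 x≉0 s) (C≉0 _ (x^[q-1]∈μ x≉0)))

      -- Comparing f(x)^q with f(y)^q gives x^(q-1) = y^(q-1), as h is injective on μ. The factors C
      -- then agree and cancel, leaving x^s = y^s, so x / y is killed by both s and q - 1.
      f-injective : ∀ (h : Carrier → Carrier) →
        (∀ {z} → z ∈ μ (suc q) → z ^ s * C z ^ q ≈ h z * C z) →
        (∀ {z w} → z ∈ μ (suc q) → w ∈ μ (suc q) → h z ≈ h w → z ≈ w) →
        gcd s (q ∸ 1) ≡ 1 → ∀ {x y} → f x ≈ f y → x ≈ y
      f-injective h conj-C h-injective gcd≡1 {x} {y} fx≈fy with y ≟ 0#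
      ... | yes y≈0 = trans (f≈0⇒≈0 (trans fx≈fy (f0≈0 y≈0))) (sym y≈0)
      ... | no  y≉0 = begin
        x              ≈⟨ x*[x⁻¹*y] y≉0 x ⟨
        y * v          ≈⟨ *-congˡ (trans (sym (*-identityʳ v)) (trans (^-congʳ v (≡.sym gcd≡1)) (^-gcd≈1 s (q ∸ 1) vˢ≈1 v^[q-1]≈1))) ⟩
        y * 1#         ≈⟨ *-identityʳ y ⟩
        y              ∎
        where
        fy≉0 : f y ≉ 0#
        fy≉0 = y≉0 ∘ f≈0⇒≈0
        x≉0 : x ≉ 0#
        x≉0 x≈0 = fy≉0 (trans (sym fx≈fy) (f0≈0 x≈0))
        z w v : Carrier
        z = x ^ (q ∸ 1)
        w = y ^ (q ∸ 1)
        v = y ⁻¹ * x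
        conj-f : ∀ {x} → x ≉ 0# → f x ^ q ≈ f x * h (x ^ (q ∸ 1))
        conj-f {x} x≉0 = begin
          (x ^ s * C u) ^ q             ≈⟨ trans (conj-* (x ^ s) (C u)) (*-congʳ (^-comm x s q)) ⟩
          (x ^ q) ^ s * C u ^ q         ≈⟨ *-congʳ (trans (^-congˡ s (sym (x^[q-1]*x≈xᑫ x))) (^-distrib-* u x s)) ⟩
          u ^ s * x ^ s * C u ^ q       ≈⟨ solve 3 (λ z x c → z :* x :* c := x :* (z :* c)) refl (u ^ s) (x ^ s) (C u ^ q) ⟩
          x ^ s * (u ^ s * C u ^ q)     ≈⟨ *-congˡ (conj-C (x^[q-1]∈μ x≉0)) ⟩
          x ^ s * (h u * C u)           ≈⟨ solve 3 (λ x h c → x :* (h :* c) := x :* c :* h) refl (x ^ s) (h u) (C u) ⟩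
          f x * h u                     ∎
          where u = x ^ (q ∸ 1)
        z≈w : z ≈ w
        z≈w = h-injective (x^[q-1]∈μ x≉0) (x^[q-1]∈μ y≉0) (*-cancelˡ-≉0 fy≉0 (begin
          f y * h z      ≈⟨ *-congʳ fx≈fy ⟨
          f x * h z      ≈⟨ conj-f x≉0 ⟨
          f x ^ q        ≈⟨ ^-congˡ q fx≈fy ⟩
          f y ^ q        ≈⟨ conj-f y≉0 ⟩
          f y * h w      ∎))
        xˢ≈yˢ : x ^ s ≈ y ^ s
        xˢ≈yˢ = *-cancelˡ-≉0 (C≉0 w (x^[q-1]∈μ y≉0)) (begin
          C w * x ^ s      ≈⟨ trans (*-comm _ _) (*-congˡ (C-cong (sym z≈w))) ⟩
          f x              ≈⟨ fx≈fy ⟩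
          f y              ≈⟨ *-comm _ _ ⟩
          C w * y ^ s      ∎)
        quotient-power : ∀ k → x ^ k ≈ y ^ k → v ^ k ≈ 1#
        quotient-power k xᵏ≈yᵏ = *-cancelˡ-≉0 (^-≉0 y≉0 k) (begin
          y ^ k * v ^ k     ≈⟨ ^-distrib-* y v k ⟨
          (y * v) ^ k       ≈⟨ ^-congˡ k (x*[x⁻¹*y] y≉0 x) ⟩
          x ^ k             ≈⟨ xᵏ≈yᵏ ⟩
          y ^ k             ≈⟨ *-identityʳ _ ⟨
          y ^ k * 1#        ∎)
        vˢ≈1 = quotient-power s xˢ≈yˢ
        v^[q-1]≈1 = quotient-power (q ∸ 1) z≈w

    module _ (f-injective : ∀ {x y} → f x ≈ f y → x ≈ y) where

      -- A zero of C in μ lifts to a non-zero x with x^(q-1) = z, and then f(x) = 0 = f(0).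
      injective⇒C≉0 : ∀ z → z ∈ μ (suc q) → C z ≉ 0#
      injective⇒C≉0 z z∈μ Cz≈0 with x , x≉0 , x^[q-1]≈z ← ∈μ⇒[q-1]-power z∈μ = x≉0 (f-injective (begin
        f x              ≈⟨ *-congˡ (trans (C-cong x^[q-1]≈z) Cz≈0) ⟩
        x ^ s * 0#       ≈⟨ zeroʳ _ ⟩
        0#               ≈⟨ f0≈0 refl ⟨
        f 0#             ∎))

      -- Such an ω gives f(ω) = C(1) = f(1).
      injective⇒no-torsion : ∀ {ω} → ω ^ s ≈ 1# → ω ^ (q ∸ 1) ≈ 1# → ω ≈ 1#
      injective⇒no-torsion ωˢ≈1 ω^[q-1]≈1 =
        f-injective (*-cong (trans ωˢ≈1 (sym (1^≈1 s))) (C-cong (trans ω^[q-1]≈1 (sym (1^≈1 (q ∸ 1))))))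

      -- A common divisor d ≥ 2 of s and q - 1 = k d makes x^((q+1)k) = 1 for every x ≠ 0,
      -- although the exponent (q+1)k = (q²-1)/d is less than q² - 1.
      injective⇒gcd≡1 : m ≥ 1 → gcd s (q ∸ 1) ≡ 1
      injective⇒gcd≡1 m≥1 with gcd s (q ∸ 1) | gcd[m,n]∣m s (q ∸ 1) | gcd[m,n]∣n s (q ∸ 1)
      ... | d | divides j s≡jd | divides k q-1≡kd = d≡1 d k s≡jd q-1≡kd
        where
        q≥2 : q ≥ 2
        q≥2 = ℕ.^-monoʳ-≤ 2 m≥1

        d≡1 : ∀ d k → s ≡ j ℕ.* d → q ∸ 1 ≡ k ℕ.* d → d ≡ 1
        -- Degenerate cases: d = 0 would force s = 0, and k = 0 would force q = 1.
        d≡1 zero k s≡ _ = contradiction s≥1 (ℕ.≤⇒≯ (ℕ.≤-reflexive (≡.trans s≡ (ℕ.*-zeroʳ j))))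
        d≡1 (suc zero) _ _ _ = ≡.refl
        d≡1 (suc (suc _)) zero _ q-1≡0 = contradiction q≥2 (ℕ.≤⇒≯ (ℕ.≤-reflexive (≡.trans (≡.sym 1+[q-1]≡q) (≡.cong suc q-1≡0))))
        d≡1 d@(suc (suc d′)) (suc k) s≡ q-1≡ = contradiction (ℕ.≤-trans N+1<q² q²≤) ℕ.1+n≰n
          where
          N : ℕ
          N = suc q ℕ.* suc k
          power≈1 : ∀ x → x ≉ 0# → x ^ N ≈ 1#
          power≈1 x x≉0 = injective⇒no-torsion
            (multiple j s≡) (multiple (suc k) q-1≡)
            where
            ω^d≈1 : (x ^ N) ^ d ≈ 1#
            ω^d≈1 = begin
              (x ^ N) ^ d                         ≈⟨ ^-assocʳ x N d ⟩
              x ^ (suc q ℕ.* suc k ℕ.* d)         ≈⟨ ^-congʳ x (≡.trans (ℕ.*-assoc (suc q) (suc k) d) (≡.trans (≡.cong (suc q ℕ.*_) (≡.sym q-1≡)) (ℕ.*-comm (suc q) (q ∸ 1)))) ⟩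
              x ^ ((q ∸ 1) ℕ.* suc q)             ≈⟨ ^-assocʳ x (q ∸ 1) (suc q) ⟨
              (x ^ (q ∸ 1)) ^ suc q               ≈⟨ x^[q-1]∈μ x≉0 ⟩
              1#                                  ∎
            multiple : ∀ {i} j → i ≡ j ℕ.* d → (x ^ N) ^ i ≈ 1#
            multiple j i≡jd = trans (^-congʳ (x ^ N) (≡.trans i≡jd (ℕ.*-comm j d)))
              (trans (sym (^-assocʳ (x ^ N) d j)) (trans (^-congˡ j ω^d≈1) (1^≈1 j)))
          q²≤ : q ℕ.^ 2 ℕ.≤ suc N
          q²≤ = exponent-bound _ power≈1
          q²≡1+N*d : suc (N ℕ.* d) ≡ q ℕ.^ 2
          q²≡1+N*d = ≡.trans (≡.cong suc (≡.trans (ℕ.*-assoc (suc q) (suc k) d) (≡.cong (suc q ℕ.*_) (≡.sym q-1≡))))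
            (≡.trans (≡.cong (λ e → suc (suc e ℕ.* (q ∸ 1))) (≡.sym 1+[q-1]≡q))
              (≡.trans (square (q ∸ 1)) (≡.cong (ℕ._^ 2) 1+[q-1]≡q)))
            where
            square : ∀ p → suc (suc (suc p) ℕ.* p) ≡ suc p ℕ.^ 2
            square = E.solve 1 (λ p → E.con 1 E.:+ (E.con 2 E.:+ p) E.:* p E.:= (E.con 1 E.:+ p) E.:^ 2) ≡.refl
              where module E = +-*-Solver
          -- From N ≥ 1 and d ≥ 2 follows N + 1 ≤ 2N ≤ N d = q² - 1.
          N+1<q² : suc (suc N) ℕ.≤ q ℕ.^ 2
          N+1<q² = ℕ.≤-trans (s≤s (ℕ.≤-trans (ℕ.≤-trans (ℕ.+-monoˡ-≤ N (s≤s z≤n)) (ℕ.≤-reflexive (≡.cong (N ℕ.+_) (≡.sym (ℕ.+-identityʳ N)))))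
            (ℕ.≤-trans (ℕ.*-monoˡ-≤ N (s≤s (s≤s (z≤n {d′})))) (ℕ.≤-reflexive (ℕ.*-comm d N)))))
            (ℕ.≤-reflexive q²≡1+N*d)

-- The permutation criterion for x^s B(x^(q-1)) A(x^(q-1)).

theorem3p11 :
    ∀ {c ℓ : Level} (m r s : ℕ) → m ≥ 1 → r ≥ 1 → s ≥ 1 →
    let q = 2 ℕ.^ m in
    s % suc q ≡ (r ℕ.+ 3) % suc q →
    (K : FiniteField c ℓ (q ℕ.^ 2)) →
    let open FieldNotions K in
    (B : Polynomial) →
    (∀ x → x ∈ μ (suc q) → eval B x ≉ 0#) →
    Permutes (λ x → x ^ r * eval (B ⁽ q ⁾) (1# / x) / eval B x) (μ (suc q)) →
    (a b : Carrier) → a ∉ 𝔽 q → b ∈ 𝔽 q → b ≉ 0# →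
    a ^ suc q + b ^ 2 ≉ 0# →
    Permutes
      (λ x → x ^ s * eval B (x ^ (q ∸ 1)) *
        (a ^ q + b * x ^ (q ∸ 1) + b * x ^ (2 ℕ.* (q ∸ 1)) + a * x ^ (3 ℕ.* (q ∸ 1))))
      U
    ⇔
    ( gcd s (q ∸ 1) ≡ 1
    × Tr m (((a ^ q + b) ^ 3 * (a + b) ^ 3) / ((a + a ^ q) ^ 2 * (a ^ suc q + b ^ 2) ^ 2))
        ≈ Tr m 1#
    × (∀ δ → δ ∉ 𝔽 q → ∀ t →
        t ^ 2
        + (((δ ^ q + δ) ^ 3 * (a ^ suc q + b ^ 2)) / (a + a ^ q) ^ 2) * t
        + ((δ + δ ^ q) ^ 6 * (a ^ q + b) ^ 3 * (a + b) ^ 3) / (a + a ^ q) ^ 6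
        ≈ 0# →
        (2 ∣ m → ¬ IsCubeIn (𝔽 q) t) × (2 ∤ m → ¬ IsCubeIn U t)))
theorem3p11 m r s m≥1 r≥1 s≥1 s≡r+3 K B B≉0 h-permutes a b a∉𝔽 b∈𝔽 b≉0 N≉0 = mk⇔
  (λ (_ , g-injective , _) →
    let f-injective = λ {x} {y} fx≈fy → g-injective {x , _} {y , _} (trans (g≈f x) (trans fx≈fy (sym (g≈f y))))
    in injective⇒gcd≡1 f-injective m≥1 ,
       Equivalence.to (no-root⇔ N≉0) λ z z∈μ Az≈0 →
         injective⇒C≉0 f-injective z z∈μ (trans (*-congˡ Az≈0) (zeroʳ _)))
  (λ (gcd≡1 , conditions) → injective⇒permutes g
    (λ {x} {y} x≈y → trans (g≈f x) (trans (f-cong x≈y) (sym (g≈f y))))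
    (λ {x} {y} gx≈gy → f-injective
      (λ z z∈μ → *-≉0 (B≉0 z z∈μ) (Equivalence.from (no-root⇔ N≉0) conditions z z∈μ))
      h conj-C
      (λ z∈μ w∈μ → proj₁ (proj₂ h-permutes) {_ , z∈μ} {_ , w∈μ})
      gcd≡1 (trans (sym (g≈f x)) (trans gx≈gy (g≈f y)))))
  where
  open FieldNotions K hiding (zero)
  open CommutativeRing commutativeRing using (setoid)
  open SetoidReasoning setoid
  open QuadraticExtension m K
  open CubicOnμ a b a∉𝔽 b∈𝔽
  open ParkLee s s≥1 (λ z → eval B z * A z) (λ z≈w → *-cong (eval-congʳ B z≈w) (A-cong z≈w))

  g h : Carrier → Carrier
  g x = x ^ s * eval B (x ^ (q ∸ 1)) *
        (a ^ q + b * x ^ (q ∸ 1) + b * x ^ (2 ℕ.* (q ∸ 1)) + a * x ^ (3 ℕ.* (q ∸ 1)))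
  h z = z ^ r * eval (B ⁽ q ⁾) (1# / z) / eval B z

  g≈f : ∀ x → g x ≈ f x
  g≈f x = trans
    (*-congˡ (+-cong (+-congˡ (*-congˡ (power 2))) (*-congˡ (power 3))))
    (*-assoc _ _ _)
    where
    power : ∀ k → x ^ (k ℕ.* (q ∸ 1)) ≈ (x ^ (q ∸ 1)) ^ k
    power k = trans (^-congʳ x (ℕ.*-comm k (q ∸ 1))) (sym (^-assocʳ x (q ∸ 1) k))

  -- On μ conjugation is inversion, so B(z)^q = B^(q)(1/z). The surplus z³ from s ≡ r + 3 turns
  -- A(z)^q back into A(z), and what remains is the given h.
  conj-C : ∀ {z} → z ∈ μ (suc q) → z ^ s * (eval B z * A z) ^ q ≈ h z * (eval B z * A z)
  conj-C {z} z∈μ = begin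
    z ^ s * (eval B z * A z) ^ q
      ≈⟨ *-cong z^s≈z^[r+3] (trans (conj-* _ _) (*-congʳ (trans (eval-conj B z) (eval-congʳ (B ⁽ q ⁾) zᑫ≈1/z)))) ⟩
    z ^ r * z ^ 3 * (b̄ * A z ^ q)
      ≈⟨ solve 4 (λ z z³ b a → z :* z³ :* (b :* a) := z :* b :* (a :* z³)) refl (z ^ r) (z ^ 3) b̄ (A z ^ q) ⟩
    z ^ r * b̄ * (A z ^ q * z ^ 3)
      ≈⟨ *-cong (sym (x/y*y≈x _ (B≉0 z z∈μ))) (A-conj z∈μ) ⟩
    h z * eval B z * A z
      ≈⟨ *-assoc _ _ _ ⟩
    h z * (eval B z * A z)  ∎
    where
    b̄ = eval (B ⁽ q ⁾) (1# / z)
    z≉0 : z ≉ 0#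
    z≉0 z≈0 = 1≉0 (trans (sym z∈μ) (trans (*-congʳ z≈0) (zeroˡ _)))
    zᑫ≈1/z : z ^ q ≈ 1# / z
    zᑫ≈1/z = *-cancelˡ-≉0 z≉0 (trans z∈μ (sym (trans (*-congˡ (*-identityˡ _)) (*-inverseʳ z z≉0))))
    z^s≈z^[r+3] : z ^ s ≈ z ^ r * z ^ 3
    z^s≈z^[r+3] = begin
      z ^ s                          ≈⟨ μ-^-% z∈μ s ⟩
      z ^ (s % suc q)                ≈⟨ ^-congʳ z s≡r+3 ⟩
      z ^ ((r ℕ.+ 3) % suc q)        ≈⟨ μ-^-% z∈μ (r ℕ.+ 3) ⟨
      z ^ (r ℕ.+ 3)                  ≈⟨ ^-homo-* z r 3 ⟩
      z ^ r * z ^ 3                  ∎
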